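{- The algebra $\mathcal{T}$ is closed under the induced product.
   Context: $\mathscr{P}$ is the set of partitions and $r_m(\lambda)$ the number of parts of $\lambda$ equal to $m$. The Faulhaber polynomial $F_l$ is the polynomial with zero constant term with $F_l(n)=\sum_{i=1}^n i^{l-1}$ for $n\ge1$. For $k\ge0,l\ge1$, $k+l$ even, $T_{k,l}(\lambda)=-\frac{B_{k+l}}{2(k+l)}(\delta_{l,1}+\delta_{k,0})+\sum_{m\ge1}m^kF_l(r_m(\lambda))$. $\mathcal{T}$ is the $\mathbb{Q}$-algebra generated by the $T_{k,l}$ under the pointwise product. The induced product $f\odot g$ of $f,g:\mathscr{P}\to\mathbb{Q}$ is defined by $\langle f\odot g\rangle_{\vec u}=\langle f\rangle_{\vec u}\langle g\rangle_{\vec u}$, where $\langle f\rangle_{\vec u}=\sum_\lambda f(\lambda)u_{\lambda_1}u_{\lambda_2}\cdots/\sum_\lambda u_{\lambda_1}u_{\lambda_2}\cdots\in\mathbb{Q}[[u_1,u_2,\ldots]]$. -}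

module Defs where

open import Data.Bool.Base using (if_then_else_)
open import Data.Empty using (⊥-elim)
open import Data.Fin.Base using (Fin; toℕ)
open import Data.Fin.Properties using (toℕ<n)
import Data.Integer.Base as ℤ
import Data.Integer.Properties as ℤ
open import Data.List.Base as List
  using (List; []; _∷_; _++_; filter; length; replicate; applyUpTo; tabulate; foldr)
open import Data.List.Properties
  using (≡-dec; filter-accept; filter-reject; filter-none; filter-++; length-++)
open import Data.List.Relation.Unary.All as All using (All; []; _∷_)
import Data.List.Relation.Unary.All.Properties as All
open import Data.List.Relation.Unary.AllPairs as AllPairs using (AllPairs; []; _∷_)
import Data.List.Relation.Unary.AllPairs.Properties as AllPairs
open import Data.List.Relation.Unary.Linked using (Linked)
open import Data.List.Relation.Unary.Linked.Properties using (AllPairs⇒Linked; Linked⇒AllPairs)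
open import Data.Nat.Base as ℕ using (ℕ; zero; suc; NonZero; _≤_; _<_; _≥_; _≡ᵇ_; z≤n; s≤s)
open import Data.Nat.Combinatorics using (_C_)
open import Data.Nat.Divisibility using (_∣_)
open import Data.Nat.Induction using (<-rec)
open import Data.Nat.ListAction using (sum)
import Data.Nat.Properties as ℕ
import Data.Nat.Solver as ℕ-Solver
open import Data.Product.Base using (Σ; ∃; _,_; proj₁; proj₂)
open import Data.Rational.Base using (ℚ; 0ℚ; 1ℚ; _+_; _*_; _-_; -_; _/_; toℚᵘ)
import Data.Rational.Properties as ℚ
import Data.Rational.Solver as ℚ-Solver
open import Data.Rational.Unnormalised.Base as ℚᵘ using (mkℚᵘ; *≡*)
import Data.Rational.Unnormalised.Properties as ℚᵘ
open import Function.Base using (_∘_; flip)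
open import Relation.Binary.Definitions using (tri<; tri≈; tri>)
open import Relation.Binary.PropositionalEquality
open import Relation.Nullary using (yes; no; recompute)
open import Relation.Unary using (Pred)
open import Level using (0ℓ)

fromℕ : ℕ → ℚ
fromℕ n = ℤ.+ n / 1

δ : ℕ → ℕ → ℚ
δ i j = if i ≡ᵇ j then 1ℚ else 0ℚ

∑₁ : ℕ → (ℕ → ℚ) → ℚ
∑₁ zero    f = 0ℚ
∑₁ (suc n) f = ∑₁ n f + f (suc n)

-- B₀ = 1 and ∑_{i ≤ n} (n+1 choose i) Bᵢ = 0 for n ≥ 1
bernoulli : ℕ → ℚ
bernoulli = <-rec (λ _ → ℚ) λ where
  zero        B → 1ℚ
  n@(suc _)   B → - (ℤ.+ 1 / suc n) *
    foldr _+_ 0ℚ (tabulate λ (i : Fin n) → fromℕ (suc n C toℕ i) * B (toℕ<n i))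

fromℕ-toℚᵘ : ∀ n → toℚᵘ (fromℕ n) ℚᵘ.≃ mkℚᵘ (ℤ.+ n) 0
fromℕ-toℚᵘ n = ℚ.toℚᵘ-fromℚᵘ (mkℚᵘ (ℤ.+ n) 0)

fromℕ-+ : ∀ m n → fromℕ (m ℕ.+ n) ≡ fromℕ m + fromℕ n
fromℕ-+ m n = ℚ.toℚᵘ-injective (begin
  toℚᵘ (fromℕ (m ℕ.+ n))               ≈⟨ fromℕ-toℚᵘ (m ℕ.+ n) ⟩
  mkℚᵘ (ℤ.+ (m ℕ.+ n)) 0                 ≈⟨ *≡* (cong (ℤ._* ℤ.+ 1)
                                           (cong₂ ℤ._+_ (sym (ℤ.*-identityʳ (ℤ.+ m))) (sym (ℤ.*-identityʳ (ℤ.+ n))))) ⟩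
  mkℚᵘ (ℤ.+ m) 0 ℚᵘ.+ mkℚᵘ (ℤ.+ n) 0       ≈⟨ ℚᵘ.+-cong (fromℕ-toℚᵘ m) (fromℕ-toℚᵘ n) ⟨
  toℚᵘ (fromℕ m) ℚᵘ.+ toℚᵘ (fromℕ n)   ≈⟨ ℚ.toℚᵘ-homo-+ (fromℕ m) (fromℕ n) ⟨
  toℚᵘ (fromℕ m + fromℕ n)             ∎)
  where open ℚᵘ.≃-Reasoning

fromℕ-* : ∀ m n → fromℕ (m ℕ.* n) ≡ fromℕ m * fromℕ n
fromℕ-* m n = ℚ.toℚᵘ-injective (begin
  toℚᵘ (fromℕ (m ℕ.* n))               ≈⟨ fromℕ-toℚᵘ (m ℕ.* n) ⟩
  mkℚᵘ (ℤ.+ (m ℕ.* n)) 0                 ≈⟨ *≡* (cong (ℤ._* ℤ.+ 1) (ℤ.pos-* m n)) ⟩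
  mkℚᵘ (ℤ.+ m) 0 ℚᵘ.* mkℚᵘ (ℤ.+ n) 0       ≈⟨ ℚᵘ.*-cong (fromℕ-toℚᵘ m) (fromℕ-toℚᵘ n) ⟨
  toℚᵘ (fromℕ m) ℚᵘ.* toℚᵘ (fromℕ n)   ≈⟨ ℚ.toℚᵘ-homo-* (fromℕ m) (fromℕ n) ⟨
  toℚᵘ (fromℕ m * fromℕ n)             ∎)
  where open ℚᵘ.≃-Reasoning

1/suc : ∀ n → (ℤ.+ 1 / suc n) * fromℕ (suc n) ≡ 1ℚ
1/suc n = ℚ.toℚᵘ-injective (begin
  toℚᵘ ((ℤ.+ 1 / suc n) * fromℕ (suc n))           ≈⟨ ℚ.toℚᵘ-homo-* (ℤ.+ 1 / suc n) (fromℕ (suc n)) ⟩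
  toℚᵘ (ℤ.+ 1 / suc n) ℚᵘ.* toℚᵘ (fromℕ (suc n))   ≈⟨ ℚᵘ.*-cong (ℚ.toℚᵘ-fromℚᵘ (mkℚᵘ (ℤ.+ 1) n)) (fromℕ-toℚᵘ (suc n)) ⟩
  mkℚᵘ (ℤ.+ 1) n ℚᵘ.* mkℚᵘ (ℤ.+ (suc n)) 0           ≈⟨ *≡* (trans (ℤ.*-identityʳ _) (trans (ℤ.*-identityˡ (ℤ.+ suc n))
                                                    (sym (trans (ℤ.*-identityˡ _) (cong (λ x → ℤ.+ suc x) (ℕ.*-identityʳ n)))))) ⟩
  ℚᵘ.1ℚᵘ                                         ∎)
  where open ℚᵘ.≃-Reasoning

∑₁-cong : ∀ {f g : ℕ → ℚ} n → (∀ i → f i ≡ g i) → ∑₁ n f ≡ ∑₁ n g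
∑₁-cong zero    eq = refl
∑₁-cong (suc n) eq = cong₂ _+_ (∑₁-cong n eq) (eq (suc n))

∑₁-- : ∀ n (f g : ℕ → ℚ) → ∑₁ n (λ i → f i - g i) ≡ ∑₁ n f - ∑₁ n g
∑₁-- zero    f g = refl
∑₁-- (suc n) f g = trans (cong (_+ (f (suc n) - g (suc n))) (∑₁-- n f g))
  (solve 4 (λ a b c d → (a :+ (:- b)) :+ (c :+ (:- d)) := (a :+ c) :+ (:- (b :+ d))) refl
    (∑₁ n f) (∑₁ n g) (f (suc n)) (g (suc n)))
  where open ℚ-Solver.+-*-Solver

∑₁-* : ∀ n c (f : ℕ → ℚ) → ∑₁ n (λ i → c * f i) ≡ c * ∑₁ n f
∑₁-* zero    c f = sym (ℚ.*-zeroʳ c)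
∑₁-* (suc n) c f = trans (cong (_+ c * f (suc n)) (∑₁-* n c f))
  (sym (ℚ.*-distribˡ-+ c (∑₁ n f) (f (suc n))))

-- c₀ ∷ c₁ ∷ ⋯ is c₀ + c₁ x + ⋯
Polynomial : Set
Polynomial = List ℚ

eval : Polynomial → ℚ → ℚ
eval []      x = 0ℚ
eval (c ∷ p) x = c + x * eval p x

constantTerm : Polynomial → ℚ
constantTerm []      = 0ℚ
constantTerm (c ∷ _) = c

record IsFaulhaber (l : ℕ) (p : Polynomial) : Set where
  field
    zeroConstantTerm : constantTerm p ≡ 0ℚ
    powerSum         : ∀ n → 1 ≤ n → eval p (fromℕ n) ≡ ∑₁ n (λ i → fromℕ (i ℕ.^ (l ℕ.∸ 1)))

IsPolynomial : (ℕ → ℚ) → Set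
IsPolynomial f = Σ Polynomial λ p → ∀ n → eval p (fromℕ n) ≡ f n

_⊕_ : Polynomial → Polynomial → Polynomial
[]      ⊕ q       = q
(c ∷ p) ⊕ []      = c ∷ p
(c ∷ p) ⊕ (d ∷ q) = (c + d) ∷ (p ⊕ q)

eval-⊕ : ∀ p q x → eval (p ⊕ q) x ≡ eval p x + eval q x
eval-⊕ []      q       x = sym (ℚ.+-identityˡ _)
eval-⊕ (c ∷ p) []      x = sym (ℚ.+-identityʳ _)
eval-⊕ (c ∷ p) (d ∷ q) x = trans (cong (λ y → (c + d) + x * y) (eval-⊕ p q x))
  (solve 5 (λ c d x y z → (c :+ d) :+ x :* (y :+ z) := (c :+ x :* y) :+ (d :+ x :* z)) refl
    c d x (eval p x) (eval q x))
  where open ℚ-Solver.+-*-Solver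

eval-scale : ∀ c p x → eval (List.map (c *_) p) x ≡ c * eval p x
eval-scale c []      x = sym (ℚ.*-zeroʳ c)
eval-scale c (d ∷ p) x = trans (cong (λ y → c * d + x * y) (eval-scale c p x))
  (solve 4 (λ c d x y → c :* d :+ x :* (c :* y) := c :* (d :+ x :* y)) refl c d x (eval p x))
  where open ℚ-Solver.+-*-Solver

isPolynomial-+ : ∀ {f g} → IsPolynomial f → IsPolynomial g → IsPolynomial (λ n → f n + g n)
isPolynomial-+ (p , p≡) (q , q≡) =
  p ⊕ q , λ n → trans (eval-⊕ p q (fromℕ n)) (cong₂ _+_ (p≡ n) (q≡ n))

isPolynomial-scale : ∀ {f} c → IsPolynomial f → IsPolynomial (λ n → c * f n)
isPolynomial-scale c (p , p≡) =
  List.map (c *_) p , λ n → trans (eval-scale c p (fromℕ n)) (cong (c *_) (p≡ n))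

isPolynomial-shift : ∀ {f} → IsPolynomial f → IsPolynomial (λ n → fromℕ n * f n)
isPolynomial-shift (p , p≡) =
  0ℚ ∷ p , λ n → trans (ℚ.+-identityˡ _) (cong (fromℕ n *_) (p≡ n))

isPolynomial-≗ : ∀ {f g} → f ≗ g → IsPolynomial f → IsPolynomial g
isPolynomial-≗ f≗g (p , p≡) = p , λ n → trans (p≡ n) (f≗g n)

rising : ℕ → ℕ → ℕ
rising zero    n = 1
rising (suc k) n = rising k n ℕ.* (n ℕ.+ k)

rising-suc : ∀ k n → rising (suc k) n ≡ n ℕ.* rising k (suc n)
rising-suc zero    n = solve 1 (λ n → con 1 :* (n :+ con 0) := n :* con 1) refl n
  where open ℕ-Solver.+-*-Solver
rising-suc (suc k) n = trans (cong (ℕ._* (n ℕ.+ suc k)) (rising-suc k n))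
  (solve 3 (λ n k r → n :* r :* (n :+ (con 1 :+ k)) := n :* (r :* ((con 1 :+ n) :+ k))) refl n k (rising k (suc n)))
  where open ℕ-Solver.+-*-Solver

rising-difference : ∀ k n → rising (suc k) (suc n) ≡ rising (suc k) n ℕ.+ suc k ℕ.* rising k (suc n)
rising-difference k n = trans
  (solve 3 (λ n k r → r :* ((con 1 :+ n) :+ k) := n :* r :+ (con 1 :+ k) :* r) refl n k (rising k (suc n)))
  (cong (ℕ._+ suc k ℕ.* rising k (suc n)) (sym (rising-suc k n)))
  where open ℕ-Solver.+-*-Solver

∑₁-rising : ∀ k n → fromℕ (suc k) * ∑₁ n (fromℕ ∘ rising k) ≡ fromℕ (rising (suc k) n)
∑₁-rising k zero    = trans (ℚ.*-zeroʳ (fromℕ (suc k))) (cong fromℕ (sym (rising-suc k 0)))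
∑₁-rising k (suc n) = begin
  fromℕ (suc k) * (∑₁ n (fromℕ ∘ rising k) + fromℕ (rising k (suc n)))
    ≡⟨ ℚ.*-distribˡ-+ (fromℕ (suc k)) _ _ ⟩
  fromℕ (suc k) * ∑₁ n (fromℕ ∘ rising k) + fromℕ (suc k) * fromℕ (rising k (suc n))
    ≡⟨ cong₂ _+_ (∑₁-rising k n) (sym (fromℕ-* (suc k) (rising k (suc n)))) ⟩
  fromℕ (rising (suc k) n) + fromℕ (suc k ℕ.* rising k (suc n))
    ≡⟨ fromℕ-+ (rising (suc k) n) (suc k ℕ.* rising k (suc n)) ⟨
  fromℕ (rising (suc k) n ℕ.+ suc k ℕ.* rising k (suc n))
    ≡⟨ cong fromℕ (rising-difference k n) ⟨
  fromℕ (rising (suc k) (suc n)) ∎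
  where open ≡-Reasoning

isPolynomial-rising : ∀ k → IsPolynomial (fromℕ ∘ rising k)
isPolynomial-rising zero    = 1ℚ ∷ [] , λ n → trans (cong (1ℚ +_) (ℚ.*-zeroʳ (fromℕ n))) (ℚ.+-identityʳ 1ℚ)
isPolynomial-rising (suc k) = isPolynomial-≗ eq
  (isPolynomial-+ (isPolynomial-shift r) (isPolynomial-scale (fromℕ k) r))
  where
  r = isPolynomial-rising k
  eq : ∀ n → fromℕ n * fromℕ (rising k n) + fromℕ k * fromℕ (rising k n) ≡ fromℕ (rising (suc k) n)
  eq n = begin
    fromℕ n * fromℕ (rising k n) + fromℕ k * fromℕ (rising k n)  ≡⟨ ℚ.*-distribʳ-+ (fromℕ (rising k n)) (fromℕ n) (fromℕ k) ⟨
    (fromℕ n + fromℕ k) * fromℕ (rising k n)                     ≡⟨ ℚ.*-comm _ (fromℕ (rising k n)) ⟩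
    fromℕ (rising k n) * (fromℕ n + fromℕ k)                     ≡⟨ cong (fromℕ (rising k n) *_) (fromℕ-+ n k) ⟨
    fromℕ (rising k n) * fromℕ (n ℕ.+ k)                         ≡⟨ fromℕ-* (rising k n) (n ℕ.+ k) ⟨
    fromℕ (rising (suc k) n)                                     ∎
    where open ≡-Reasoning

-- By i^(l+1) rising k i = i^l rising (k+1) i - k i^l rising k i, with the sum at l = 0 in closed form.
isPolynomial-∑₁ : ∀ l k → IsPolynomial (λ n → ∑₁ n (λ i → fromℕ (i ℕ.^ l ℕ.* rising k i)))
isPolynomial-∑₁ zero k = isPolynomial-≗ eq
  (isPolynomial-scale (ℤ.+ 1 / suc k) (isPolynomial-rising (suc k)))
  where
  eq : ∀ n → (ℤ.+ 1 / suc k) * fromℕ (rising (suc k) n) ≡ ∑₁ n (λ i → fromℕ (1 ℕ.* rising k i))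
  eq n = begin
    (ℤ.+ 1 / suc k) * fromℕ (rising (suc k) n)                       ≡⟨ cong ((ℤ.+ 1 / suc k) *_) (∑₁-rising k n) ⟨
    (ℤ.+ 1 / suc k) * (fromℕ (suc k) * ∑₁ n (fromℕ ∘ rising k))      ≡⟨ ℚ.*-assoc (ℤ.+ 1 / suc k) _ _ ⟨
    (ℤ.+ 1 / suc k) * fromℕ (suc k) * ∑₁ n (fromℕ ∘ rising k)        ≡⟨ cong (_* ∑₁ n (fromℕ ∘ rising k)) (1/suc k) ⟩
    1ℚ * ∑₁ n (fromℕ ∘ rising k)                                   ≡⟨ ℚ.*-identityˡ _ ⟩
    ∑₁ n (fromℕ ∘ rising k)                                        ≡⟨ ∑₁-cong n (λ i → cong fromℕ (sym (ℕ.*-identityˡ (rising k i)))) ⟩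
    ∑₁ n (λ i → fromℕ (1 ℕ.* rising k i))                          ∎
    where open ≡-Reasoning
isPolynomial-∑₁ (suc l) k = isPolynomial-≗ eq
  (isPolynomial-+ (isPolynomial-∑₁ l (suc k)) (isPolynomial-scale (- fromℕ k) (isPolynomial-∑₁ l k)))
  where
  S : ℕ → ℕ → ℕ → ℚ
  S l k i = fromℕ (i ℕ.^ l ℕ.* rising k i)
  term : ∀ i → S l (suc k) i - fromℕ k * S l k i ≡ S (suc l) k i
  term i = begin
    S l (suc k) i - fromℕ k * S l k i
      ≡⟨ cong (λ x → fromℕ x - fromℕ k * S l k i)
           (solve 4 (λ x r i k → x :* (r :* (i :+ k)) := i :* x :* r :+ k :* (x :* r)) refl (i ℕ.^ l) (rising k i) i k) ⟩
    fromℕ (i ℕ.^ suc l ℕ.* rising k i ℕ.+ k ℕ.* (i ℕ.^ l ℕ.* rising k i)) - fromℕ k * S l k i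
      ≡⟨ cong (_- fromℕ k * S l k i) (trans (fromℕ-+ (i ℕ.^ suc l ℕ.* rising k i) (k ℕ.* (i ℕ.^ l ℕ.* rising k i)))
           (cong (S (suc l) k i +_) (fromℕ-* k (i ℕ.^ l ℕ.* rising k i)))) ⟩
    (S (suc l) k i + fromℕ k * S l k i) - fromℕ k * S l k i
      ≡⟨ trans (ℚ.+-assoc (S (suc l) k i) _ _)
           (trans (cong (S (suc l) k i +_) (ℚ.+-inverseʳ (fromℕ k * S l k i))) (ℚ.+-identityʳ _)) ⟩
    S (suc l) k i ∎
    where
    open ≡-Reasoning
    open ℕ-Solver.+-*-Solver
  eq : ∀ n → ∑₁ n (S l (suc k)) + - fromℕ k * ∑₁ n (S l k) ≡ ∑₁ n (S (suc l) k)
  eq n = begin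
    ∑₁ n (S l (suc k)) + - fromℕ k * ∑₁ n (S l k)       ≡⟨ cong (λ x → ∑₁ n (S l (suc k)) + x) (ℚ.neg-distribˡ-* (fromℕ k) (∑₁ n (S l k))) ⟨
    ∑₁ n (S l (suc k)) - fromℕ k * ∑₁ n (S l k)         ≡⟨ cong (λ x → ∑₁ n (S l (suc k)) - x) (∑₁-* n (fromℕ k) (S l k)) ⟨
    ∑₁ n (S l (suc k)) - ∑₁ n (λ i → fromℕ k * S l k i) ≡⟨ ∑₁-- n (S l (suc k)) _ ⟨
    ∑₁ n (λ i → S l (suc k) i - fromℕ k * S l k i)      ≡⟨ ∑₁-cong n term ⟩
    ∑₁ n (S (suc l) k)                                  ∎
    where open ≡-Reasoning

constantTerm≡eval-0 : ∀ p → constantTerm p ≡ eval p 0ℚ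
constantTerm≡eval-0 []      = refl
constantTerm≡eval-0 (c ∷ p) = sym (trans (cong (c +_) (ℚ.*-zeroˡ (eval p 0ℚ))) (ℚ.+-identityʳ c))

faulhaber-exists : ∀ l → ∃ (IsFaulhaber l)
faulhaber-exists l = p , record
  { zeroConstantTerm = trans (constantTerm≡eval-0 p) (p≡ 0)
  ; powerSum         = λ n _ → trans (p≡ n) (∑₁-cong n λ i → cong fromℕ (ℕ.*-identityʳ (i ℕ.^ (l ℕ.∸ 1))))
  }
  where
  p  = proj₁ (isPolynomial-∑₁ (l ℕ.∸ 1) 0)
  p≡ = proj₂ (isPolynomial-∑₁ (l ℕ.∸ 1) 0)

faulhaber : (l : ℕ) .{{_ : NonZero l}} → Polynomial
faulhaber l = proj₁ (faulhaber-exists l)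

isFaulhaber : ∀ l .{{_ : NonZero l}} → IsFaulhaber l (faulhaber l)
isFaulhaber l = proj₂ (faulhaber-exists l)

record Partition : Set where
  constructor mkPartition
  field
    parts        : List ℕ
    .decreasing  : Linked _≥_ parts
    .positive    : All (1 ≤_) parts

open Partition public

size : Partition → ℕ
size ν = sum (parts ν)

count : ℕ → List ℕ → ℕ
count m xs = length (filter (m ℕ.≟_) xs)

r : ℕ → Partition → ℕ
r m ν = count m (parts ν)

private
  2[k+l]≢0 : ∀ k l .{{_ : NonZero l}} → NonZero (2 ℕ.* (k ℕ.+ l))
  2[k+l]≢0 k (suc l) rewrite ℕ.+-suc k l = _

-- Parts of ν are at most size ν, and F_l(0) = 0, so the sum over all m ≥ 1 stops at size ν.
T : (k l : ℕ) .{{_ : NonZero l}} → Partition → ℚ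
T k l ν =
  - (bernoulli (k ℕ.+ l) * (_/_ (ℤ.+ 1) (2 ℕ.* (k ℕ.+ l)) {{2[k+l]≢0 k l}})) * (δ l 1 + δ k 0)
  + ∑₁ (size ν) (λ m → fromℕ (m ℕ.^ k) * eval (faulhaber l) (fromℕ (r m ν)))

-- The unital ℚ-subalgebra generated by the T k l; resp-≗ stands in for function extensionality.
data 𝒯 : Pred (Partition → ℚ) 0ℓ where
  generator : ∀ k l .{{_ : NonZero l}} → 2 ∣ k ℕ.+ l → 𝒯 (T k l)
  constant  : ∀ c → 𝒯 (λ _ → c)
  add       : ∀ {f g} → 𝒯 f → 𝒯 g → 𝒯 (λ ν → f ν + g ν)
  multiply  : ∀ {f g} → 𝒯 f → 𝒯 g → 𝒯 (λ ν → f ν * g ν)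
  resp-≗    : ∀ {f g} → f ≗ g → 𝒯 f → 𝒯 g

-- e₁ ∷ ⋯ ∷ eₙ ∷ [] is u₁^e₁ ⋯ uₙ^eₙ; trailing zeros do not change the monomial.
Monomial : Set
Monomial = List ℕ

degree : Monomial → ℕ
degree = sum

record PowerSeries : Set where
  field
    coeff    : Monomial → ℚ
    coherent : ∀ e → coeff (e ++ 0 ∷ []) ≡ coeff e

open PowerSeries public

infix 4 _≈_
_≈_ : PowerSeries → PowerSeries → Set
F ≈ G = ∀ e → coeff F e ≡ coeff G e

antidiagonal : ℕ → (ℕ → ℕ → ℚ) → ℚ
antidiagonal zero    φ = φ 0 0
antidiagonal (suc n) φ = φ 0 (suc n) + antidiagonal n (λ a b → φ (suc a) b)

-- factorisations e Φ is the sum of Φ α β over all pairs of monomials with product e.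
factorisations : Monomial → (Monomial → Monomial → ℚ) → ℚ
factorisations []      Φ = Φ [] []
factorisations (n ∷ e) Φ = antidiagonal n λ a b → factorisations e λ α β → Φ (a ∷ α) (b ∷ β)

antidiagonal-cong : ∀ n {φ ψ : ℕ → ℕ → ℚ} → (∀ a b → a ℕ.+ b ≡ n → φ a b ≡ ψ a b) →
  antidiagonal n φ ≡ antidiagonal n ψ
antidiagonal-cong zero    eq = eq 0 0 refl
antidiagonal-cong (suc n) eq = cong₂ _+_ (eq 0 (suc n) refl)
  (antidiagonal-cong n λ a b a+b≡n → eq (suc a) b (cong suc a+b≡n))

factorisations-cong : ∀ e {Φ Ψ : Monomial → Monomial → ℚ} →
  (∀ α β → degree α ℕ.+ degree β ≡ degree e → Φ α β ≡ Ψ α β) →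
  factorisations e Φ ≡ factorisations e Ψ
factorisations-cong []      eq = eq [] [] refl
factorisations-cong (n ∷ e) eq = antidiagonal-cong n λ a b a+b≡n →
  factorisations-cong e λ α β α+β≡e → eq (a ∷ α) (b ∷ β) (begin
    (a ℕ.+ degree α) ℕ.+ (b ℕ.+ degree β)  ≡⟨ solve 4 (λ a x b y → (a :+ x) :+ (b :+ y) := (a :+ b) :+ (x :+ y)) refl
                                                a (degree α) b (degree β) ⟩
    (a ℕ.+ b) ℕ.+ (degree α ℕ.+ degree β)  ≡⟨ cong₂ ℕ._+_ a+b≡n α+β≡e ⟩
    n ℕ.+ degree e                         ∎)
  where
  open ≡-Reasoning
  open ℕ-Solver.+-*-Solver

factorisations-coherent : ∀ e {Φ : Monomial → Monomial → ℚ} →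
  (∀ α β → Φ (α ++ 0 ∷ []) (β ++ 0 ∷ []) ≡ Φ α β) →
  factorisations (e ++ 0 ∷ []) Φ ≡ factorisations e Φ
factorisations-coherent []      eq = eq [] []
factorisations-coherent (n ∷ e) eq = antidiagonal-cong n λ a b _ →
  factorisations-coherent e (λ α β → eq (a ∷ α) (b ∷ β))

infixl 7 _⋆_
_⋆_ : PowerSeries → PowerSeries → PowerSeries
coeff    (F ⋆ G) e = factorisations e λ α β → coeff F α * coeff G β
coherent (F ⋆ G) e = factorisations-coherent e λ α β → cong₂ _*_ (coherent F α) (coherent G β)

infixl 6 _⊖_
_⊖_ : PowerSeries → PowerSeries → PowerSeries
coeff    (F ⊖ G) e = coeff F e - coeff G e
coherent (F ⊖ G) e = cong₂ _-_ (coherent F e) (coherent G e)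

degree-++0 : ∀ e → degree (e ++ 0 ∷ []) ≡ degree e
degree-++0 []      = refl
degree-++0 (n ∷ e) = cong (n ℕ.+_) (degree-++0 e)

𝟙 : PowerSeries
coeff    𝟙 e = δ (degree e) 0
coherent 𝟙 e = cong (λ d → δ d 0) (degree-++0 e)

infixr 8 _^_
_^_ : PowerSeries → ℕ → PowerSeries
F ^ zero  = 𝟙
F ^ suc n = F ⋆ F ^ n

∑₀ : ℕ → (ℕ → ℚ) → ℚ
∑₀ zero    f = f 0
∑₀ (suc n) f = ∑₀ n f + f (suc n)

∑₀-cong : ∀ n {f g : ℕ → ℚ} → (∀ i → f i ≡ g i) → ∑₀ n f ≡ ∑₀ n g
∑₀-cong zero    eq = eq 0
∑₀-cong (suc n) eq = cong₂ _+_ (∑₀-cong n eq) (eq (suc n))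

-- For F with constant coefficient 1, the geometric series ∑ₖ (1 - F)^k;
-- its terms with k > degree e do not contribute to the coefficient at e.
infix 9 _⁻¹
_⁻¹ : PowerSeries → PowerSeries
coeff    (F ⁻¹) e = ∑₀ (degree e) λ k → coeff ((𝟙 ⊖ F) ^ k) e
coherent (F ⁻¹) e rewrite degree-++0 e = ∑₀-cong (degree e) λ k → coherent ((𝟙 ⊖ F) ^ k) e

antidiagonal-+ : ∀ n (φ ψ : ℕ → ℕ → ℚ) →
  antidiagonal n (λ a b → φ a b + ψ a b) ≡ antidiagonal n φ + antidiagonal n ψ
antidiagonal-+ zero    φ ψ = refl
antidiagonal-+ (suc n) φ ψ = trans
  (cong (λ x → (φ 0 (suc n) + ψ 0 (suc n)) + x) (antidiagonal-+ n (λ a b → φ (suc a) b) (λ a b → ψ (suc a) b)))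
  (solve 4 (λ a b c d → (a :+ b) :+ (c :+ d) := (a :+ c) :+ (b :+ d)) refl
    (φ 0 (suc n)) (ψ 0 (suc n)) (antidiagonal n (λ a b → φ (suc a) b)) (antidiagonal n (λ a b → ψ (suc a) b)))
  where open ℚ-Solver.+-*-Solver

antidiagonal-* : ∀ n c (φ : ℕ → ℕ → ℚ) → antidiagonal n (λ a b → c * φ a b) ≡ c * antidiagonal n φ
antidiagonal-* zero    c φ = refl
antidiagonal-* (suc n) c φ = trans
  (cong (λ x → c * φ 0 (suc n) + x) (antidiagonal-* n c (λ a b → φ (suc a) b)))
  (sym (ℚ.*-distribˡ-+ c _ _))

antidiagonal-last : ∀ n (φ : ℕ → ℕ → ℚ) →
  antidiagonal (suc n) φ ≡ antidiagonal n (λ a b → φ a (suc b)) + φ (suc n) 0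
antidiagonal-last zero    φ = refl
antidiagonal-last (suc n) φ = trans
  (cong (λ x → φ 0 (suc (suc n)) + x) (antidiagonal-last n (λ a b → φ (suc a) b)))
  (sym (ℚ.+-assoc (φ 0 (suc (suc n))) _ _))

antidiagonal-flip : ∀ n (φ : ℕ → ℕ → ℚ) → antidiagonal n φ ≡ antidiagonal n (flip φ)
antidiagonal-flip zero    φ = refl
antidiagonal-flip (suc n) φ = begin
  φ 0 (suc n) + antidiagonal n (λ a b → φ (suc a) b)     ≡⟨ cong (λ x → φ 0 (suc n) + x) (antidiagonal-flip n (λ a b → φ (suc a) b)) ⟩
  φ 0 (suc n) + antidiagonal n (λ a b → φ (suc b) a)     ≡⟨ ℚ.+-comm (φ 0 (suc n)) _ ⟩
  antidiagonal n (λ a b → φ (suc b) a) + φ 0 (suc n)     ≡⟨ antidiagonal-last n (flip φ) ⟨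
  antidiagonal (suc n) (flip φ)                          ∎
  where open ≡-Reasoning

antidiagonal-assoc : ∀ n (ψ : ℕ → ℕ → ℕ → ℚ) →
  antidiagonal n (λ a c → antidiagonal a (λ x y → ψ x y c)) ≡
  antidiagonal n (λ x b → antidiagonal b (λ y c → ψ x y c))
antidiagonal-assoc zero    ψ = refl
antidiagonal-assoc (suc n) ψ = begin
  ψ 0 0 (suc n) + antidiagonal n (λ a c → ψ 0 (suc a) c + antidiagonal a (λ x y → ψ (suc x) y c))
    ≡⟨ cong (λ x → ψ 0 0 (suc n) + x) (antidiagonal-+ n (λ a c → ψ 0 (suc a) c) _) ⟩
  ψ 0 0 (suc n) + (antidiagonal n (λ a c → ψ 0 (suc a) c) + antidiagonal n (λ a c → antidiagonal a (λ x y → ψ (suc x) y c)))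
    ≡⟨ ℚ.+-assoc (ψ 0 0 (suc n)) _ _ ⟨
  antidiagonal (suc n) (ψ 0) + antidiagonal n (λ a c → antidiagonal a (λ x y → ψ (suc x) y c))
    ≡⟨ cong (λ x → antidiagonal (suc n) (ψ 0) + x) (antidiagonal-assoc n (λ x y c → ψ (suc x) y c)) ⟩
  antidiagonal (suc n) (ψ 0) + antidiagonal n (λ x b → antidiagonal b (λ y c → ψ (suc x) y c)) ∎
  where open ≡-Reasoning

factorisations-+ : ∀ e (Φ Ψ : Monomial → Monomial → ℚ) →
  factorisations e (λ α β → Φ α β + Ψ α β) ≡ factorisations e Φ + factorisations e Ψ
factorisations-+ []      Φ Ψ = refl
factorisations-+ (n ∷ e) Φ Ψ = trans
  (antidiagonal-cong n λ a b _ → factorisations-+ e (λ α β → Φ (a ∷ α) (b ∷ β)) (λ α β → Ψ (a ∷ α) (b ∷ β)))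
  (antidiagonal-+ n _ _)

factorisations-* : ∀ e c (Φ : Monomial → Monomial → ℚ) →
  factorisations e (λ α β → c * Φ α β) ≡ c * factorisations e Φ
factorisations-* []      c Φ = refl
factorisations-* (n ∷ e) c Φ = trans
  (antidiagonal-cong n λ a b _ → factorisations-* e c (λ α β → Φ (a ∷ α) (b ∷ β)))
  (antidiagonal-* n c _)

factorisations-flip : ∀ e (Φ : Monomial → Monomial → ℚ) → factorisations e Φ ≡ factorisations e (flip Φ)
factorisations-flip []      Φ = refl
factorisations-flip (n ∷ e) Φ = trans
  (antidiagonal-cong n λ a b _ → factorisations-flip e (λ α β → Φ (a ∷ α) (b ∷ β)))
  (antidiagonal-flip n _)

factorisations-antidiagonal : ∀ e n (Φ : ℕ → ℕ → Monomial → Monomial → ℚ) →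
  factorisations e (λ α β → antidiagonal n (λ a b → Φ a b α β)) ≡
  antidiagonal n (λ a b → factorisations e (Φ a b))
factorisations-antidiagonal e zero    Φ = refl
factorisations-antidiagonal e (suc n) Φ = trans
  (factorisations-+ e (Φ 0 (suc n)) _)
  (cong (λ x → factorisations e (Φ 0 (suc n)) + x) (factorisations-antidiagonal e n (λ a b → Φ (suc a) b)))

factorisations-assoc : ∀ e (Ψ : Monomial → Monomial → Monomial → ℚ) →
  factorisations e (λ α γ → factorisations α (λ ξ η → Ψ ξ η γ)) ≡
  factorisations e (λ ξ β → factorisations β (λ η γ → Ψ ξ η γ))
factorisations-assoc []      Ψ = refl
factorisations-assoc (n ∷ e) Ψ = begin
  antidiagonal n (λ a c → factorisations e (λ α γ → antidiagonal a (λ x y → factorisations α (λ ξ η → Ψ (x ∷ ξ) (y ∷ η) (c ∷ γ)))))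
    ≡⟨ antidiagonal-cong n (λ a c _ → factorisations-antidiagonal e a _) ⟩
  antidiagonal n (λ a c → antidiagonal a (λ x y → factorisations e (λ α γ → factorisations α (λ ξ η → Ψ (x ∷ ξ) (y ∷ η) (c ∷ γ)))))
    ≡⟨ antidiagonal-cong n (λ a c _ → antidiagonal-cong a (λ x y _ → factorisations-assoc e (λ ξ η γ → Ψ (x ∷ ξ) (y ∷ η) (c ∷ γ)))) ⟩
  antidiagonal n (λ a c → antidiagonal a (λ x y → factorisations e (λ ξ β → factorisations β (λ η γ → Ψ (x ∷ ξ) (y ∷ η) (c ∷ γ)))))
    ≡⟨ antidiagonal-assoc n _ ⟩
  antidiagonal n (λ x b → antidiagonal b (λ y c → factorisations e (λ ξ β → factorisations β (λ η γ → Ψ (x ∷ ξ) (y ∷ η) (c ∷ γ)))))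
    ≡⟨ antidiagonal-cong n (λ x b _ → factorisations-antidiagonal e b _) ⟨
  antidiagonal n (λ x b → factorisations e (λ ξ β → antidiagonal b (λ y c → factorisations β (λ η γ → Ψ (x ∷ ξ) (y ∷ η) (c ∷ γ))))) ∎
  where open ≡-Reasoning

⋆-cong : ∀ F F′ G G′ → F ≈ F′ → G ≈ G′ → F ⋆ G ≈ F′ ⋆ G′
⋆-cong _ _ _ _ F≈F′ G≈G′ e = factorisations-cong e λ α β _ → cong₂ _*_ (F≈F′ α) (G≈G′ β)

⋆-comm : ∀ F G → F ⋆ G ≈ G ⋆ F
⋆-comm F G e = trans (factorisations-flip e _)
  (factorisations-cong e λ α β _ → ℚ.*-comm (coeff F β) (coeff G α))

⋆-assoc : ∀ F G H → (F ⋆ G) ⋆ H ≈ F ⋆ (G ⋆ H)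
⋆-assoc F G H e = begin
  factorisations e (λ α γ → factorisations α (λ ξ η → coeff F ξ * coeff G η) * coeff H γ)
    ≡⟨ factorisations-cong e (λ α γ _ → trans (ℚ.*-comm _ (coeff H γ)) (trans (sym (factorisations-* α (coeff H γ) _))
         (factorisations-cong α λ ξ η _ → trans (ℚ.*-comm (coeff H γ) _) (ℚ.*-assoc (coeff F ξ) (coeff G η) (coeff H γ))))) ⟩
  factorisations e (λ α γ → factorisations α (λ ξ η → coeff F ξ * (coeff G η * coeff H γ)))
    ≡⟨ factorisations-assoc e (λ ξ η γ → coeff F ξ * (coeff G η * coeff H γ)) ⟩
  factorisations e (λ ξ β → factorisations β (λ η γ → coeff F ξ * (coeff G η * coeff H γ)))
    ≡⟨ factorisations-cong e (λ ξ β _ → factorisations-* β (coeff F ξ) _) ⟩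
  factorisations e (λ ξ β → coeff F ξ * factorisations β (λ η γ → coeff G η * coeff H γ)) ∎
  where open ≡-Reasoning

factorisations-0 : ∀ e {Φ : Monomial → Monomial → ℚ} →
  (∀ α β → degree α ℕ.+ degree β ≡ degree e → Φ α β ≡ 0ℚ) → factorisations e Φ ≡ 0ℚ
factorisations-0 e {Φ} eq = begin
  factorisations e Φ                  ≡⟨ factorisations-cong e (λ α β d → trans (eq α β d) (sym (ℚ.*-zeroˡ 0ℚ))) ⟩
  factorisations e (λ _ _ → 0ℚ * 0ℚ)  ≡⟨ factorisations-* e 0ℚ (λ _ _ → 0ℚ) ⟩
  0ℚ * factorisations e (λ _ _ → 0ℚ)  ≡⟨ ℚ.*-zeroˡ (factorisations e (λ _ _ → 0ℚ)) ⟩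
  0ℚ                                  ∎
  where open ≡-Reasoning

antidiagonal-0 : ∀ n {φ : ℕ → ℕ → ℚ} → (∀ a b → φ a b ≡ 0ℚ) → antidiagonal n φ ≡ 0ℚ
antidiagonal-0 zero    eq = eq 0 0
antidiagonal-0 (suc n) eq = trans (cong₂ _+_ (eq 0 (suc n)) (antidiagonal-0 n λ a b → eq (suc a) b)) (ℚ.+-identityˡ 0ℚ)

⋆-identityˡ : ∀ F → 𝟙 ⋆ F ≈ F
⋆-identityˡ F e = go e (coeff F)
  where
  go : ∀ e (f : Monomial → ℚ) → factorisations e (λ α β → δ (degree α) 0 * f β) ≡ f e
  tail : ∀ n e (f : Monomial → ℚ) a b → factorisations e (λ α β → δ (suc a ℕ.+ degree α) 0 * f (b ∷ β)) ≡ 0ℚ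
  tail n e f a b = factorisations-0 e λ α β _ → ℚ.*-zeroˡ (f (b ∷ β))
  go []          f = ℚ.*-identityˡ (f [])
  go (zero  ∷ e) f = go e (λ β → f (0 ∷ β))
  go (suc n ∷ e) f = trans
    (cong₂ _+_ (go e (λ β → f (suc n ∷ β))) (antidiagonal-0 n (tail n e f)))
    (ℚ.+-identityʳ _)

⋆-identityʳ : ∀ F → F ⋆ 𝟙 ≈ F
⋆-identityʳ F e = trans (⋆-comm F 𝟙 e) (⋆-identityˡ F e)

^-vanishes : ∀ X → (∀ e → degree e ≡ 0 → coeff X e ≡ 0ℚ) → ∀ k e → degree e < k → coeff (X ^ k) e ≡ 0ℚ
^-vanishes X X₀ (suc k) e (s≤s e≤k) = factorisations-0 e vanish
  where
  vanish : ∀ α β → degree α ℕ.+ degree β ≡ degree e → coeff X α * coeff (X ^ k) β ≡ 0ℚ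
  vanish α β d with degree α in eq
  ... | zero  = trans (cong (_* coeff (X ^ k) β) (X₀ α eq)) (ℚ.*-zeroˡ (coeff (X ^ k) β))
  ... | suc a = trans
    (cong (coeff X α *_) (^-vanishes X X₀ k β
      (ℕ.≤-trans (s≤s (ℕ.m≤n+m (degree β) a)) (ℕ.≤-trans (ℕ.≤-reflexive d) e≤k))))
    (ℚ.*-zeroʳ (coeff X α))

∑₀-extend : ∀ d k {f : ℕ → ℚ} → (∀ i → d < i → f i ≡ 0ℚ) → ∑₀ (k ℕ.+ d) f ≡ ∑₀ d f
∑₀-extend d zero    eq = refl
∑₀-extend d (suc k) eq = trans
  (cong₂ _+_ (∑₀-extend d k eq) (eq (suc k ℕ.+ d) (s≤s (ℕ.m≤n+m d k))))
  (ℚ.+-identityʳ _)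

factorisations-∑₀ : ∀ e n (Φ : ℕ → Monomial → Monomial → ℚ) →
  factorisations e (λ α β → ∑₀ n (λ k → Φ k α β)) ≡ ∑₀ n (λ k → factorisations e (Φ k))
factorisations-∑₀ e zero    Φ = refl
factorisations-∑₀ e (suc n) Φ = trans
  (factorisations-+ e _ (Φ (suc n)))
  (cong (_+ factorisations e (Φ (suc n))) (factorisations-∑₀ e n Φ))

∑₀-* : ∀ n c (f : ℕ → ℚ) → c * ∑₀ n f ≡ ∑₀ n (λ k → c * f k)
∑₀-* zero    c f = refl
∑₀-* (suc n) c f = trans (ℚ.*-distribˡ-+ c _ _) (cong (_+ c * f (suc n)) (∑₀-* n c f))

∑₀-telescope : ∀ n (f : ℕ → ℚ) → ∑₀ n (λ k → f k - f (suc k)) ≡ f 0 - f (suc n)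
∑₀-telescope zero    f = refl
∑₀-telescope (suc n) f = trans (cong (_+ (f (suc n) - f (suc (suc n)))) (∑₀-telescope n f))
  (solve 3 (λ a b c → (a :+ (:- b)) :+ (b :+ (:- c)) := a :+ (:- c)) refl (f 0) (f (suc n)) (f (suc (suc n))))
  where open ℚ-Solver.+-*-Solver

coeff-degree0 : ∀ F e → degree e ≡ 0 → coeff F e ≡ coeff F []
coeff-degree0 F e d = go (coeff F) (coherent F) e d
  where
  go : ∀ (f : Monomial → ℚ) → (∀ e → f (e ++ 0 ∷ []) ≡ f e) → ∀ e → degree e ≡ 0 → f e ≡ f []
  go f coh []         d = refl
  go f coh (zero ∷ e) d = trans (go (λ e → f (0 ∷ e)) (λ e → coh (0 ∷ e)) e d) (coh [])

⋆-inverseʳ : ∀ F → coeff F [] ≡ 1ℚ → F ⋆ F ⁻¹ ≈ 𝟙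
⋆-inverseʳ F F₀ e = begin
  factorisations e (λ α β → coeff F α * ∑₀ (degree β) (λ k → coeff (X ^ k) β))
    ≡⟨ factorisations-cong e (λ α β d → cong (coeff F α *_) (trans
         (sym (∑₀-extend (degree β) (degree α) (λ k → ^-vanishes X X₀ k β)))
         (cong (λ n → ∑₀ n (λ k → coeff (X ^ k) β)) d))) ⟩
  factorisations e (λ α β → coeff F α * ∑₀ (degree e) (λ k → coeff (X ^ k) β))
    ≡⟨ factorisations-cong e (λ α β _ → ∑₀-* (degree e) (coeff F α) _) ⟩
  factorisations e (λ α β → ∑₀ (degree e) (λ k → coeff F α * coeff (X ^ k) β))
    ≡⟨ factorisations-∑₀ e (degree e) (λ k α β → coeff F α * coeff (X ^ k) β) ⟩
  ∑₀ (degree e) (λ k → coeff (F ⋆ X ^ k) e)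
    ≡⟨ ∑₀-cong (degree e) step ⟩
  ∑₀ (degree e) (λ k → coeff (X ^ k) e - coeff (X ^ suc k) e)
    ≡⟨ ∑₀-telescope (degree e) (λ k → coeff (X ^ k) e) ⟩
  coeff 𝟙 e - coeff (X ^ suc (degree e)) e
    ≡⟨ cong (λ x → coeff 𝟙 e - x) (^-vanishes X X₀ (suc (degree e)) e ℕ.≤-refl) ⟩
  coeff 𝟙 e - 0ℚ
    ≡⟨ ℚ.+-identityʳ (coeff 𝟙 e) ⟩
  coeff 𝟙 e ∎
  where
  open ≡-Reasoning
  X = 𝟙 ⊖ F
  X₀ : ∀ e → degree e ≡ 0 → coeff X e ≡ 0ℚ
  X₀ e d = cong₂ (λ x y → δ x 0 - y) d (trans (coeff-degree0 F e d) F₀)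
  step : ∀ k → coeff (F ⋆ X ^ k) e ≡ coeff (X ^ k) e - coeff (X ^ suc k) e
  step k = begin
    coeff (F ⋆ X ^ k) e
      ≡⟨ solve 2 (λ f x → f := (f :+ x) :+ (:- x)) refl (coeff (F ⋆ X ^ k) e) (coeff (X ^ suc k) e) ⟩
    (coeff (F ⋆ X ^ k) e + coeff (X ^ suc k) e) - coeff (X ^ suc k) e
      ≡⟨ cong (_- coeff (X ^ suc k) e) (trans (sym (factorisations-+ e _ _)) (trans
           (factorisations-cong e λ α β _ → solve 3 (λ f o x → f :* x :+ (o :+ (:- f)) :* x := o :* x) refl
              (coeff F α) (coeff 𝟙 α) (coeff (X ^ k) β))
           (⋆-identityˡ (X ^ k) e))) ⟩
    coeff (X ^ k) e - coeff (X ^ suc k) e ∎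
    where open ℚ-Solver.+-*-Solver

-- The parts of the partition with e₁ parts i, e₂ parts i + 1, …
partsFrom : ℕ → Monomial → List ℕ
partsFrom i []      = []
partsFrom i (n ∷ e) = partsFrom (suc i) e ++ replicate n i

partsFrom-≥ : ∀ i e → All (i ≤_) (partsFrom i e)
partsFrom-≥ i []      = []
partsFrom-≥ i (n ∷ e) = All.++⁺ (All.map ℕ.<⇒≤ (partsFrom-≥ (suc i) e)) (All.replicate⁺ n ℕ.≤-refl)

partsFrom-decreasing : ∀ i e → AllPairs _≥_ (partsFrom i e)
partsFrom-decreasing i []      = []
partsFrom-decreasing i (n ∷ e) = AllPairs.++⁺ (partsFrom-decreasing (suc i) e) (go n)
  (All.map (λ i<x → All.replicate⁺ n (ℕ.<⇒≤ i<x)) (partsFrom-≥ (suc i) e))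
  where
  go : ∀ n → AllPairs _≥_ (replicate n i)
  go zero    = []
  go (suc n) = All.replicate⁺ n ℕ.≤-refl ∷ go n

-- The partition ν with u_{ν₁} u_{ν₂} ⋯ equal to a given monomial, and conversely.
partition : Monomial → Partition
partition e = mkPartition (partsFrom 1 e) (AllPairs⇒Linked (partsFrom-decreasing 1 e)) (partsFrom-≥ 1 e)

monomial : Partition → Monomial
monomial ν = applyUpTo (λ i → r (suc i) ν) (size ν)

exponent : Monomial → ℕ → ℕ
exponent []      i       = 0
exponent (n ∷ e) zero    = n
exponent (n ∷ e) (suc i) = exponent e i

count-++ : ∀ m xs ys → count m (xs ++ ys) ≡ count m xs ℕ.+ count m ys
count-++ m xs ys = trans (cong length (filter-++ (m ℕ.≟_) xs ys)) (length-++ (filter (m ℕ.≟_) xs))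

count-accept : ∀ m xs → count m (m ∷ xs) ≡ suc (count m xs)
count-accept m xs = cong length (filter-accept (m ℕ.≟_) refl)

count-reject : ∀ {m x} xs → m ≢ x → count m (x ∷ xs) ≡ count m xs
count-reject {m} xs m≢x = cong length (filter-reject (m ℕ.≟_) m≢x)

count-none : ∀ {m xs} → All (m ≢_) xs → count m xs ≡ 0
count-none {m} none = cong length (filter-none (m ℕ.≟_) none)

count-replicate : ∀ n i → count i (replicate n i) ≡ n
count-replicate zero    i = refl
count-replicate (suc n) i = trans (count-accept i (replicate n i)) (cong suc (count-replicate n i))

count-partsFrom : ∀ i e j → count (j ℕ.+ i) (partsFrom i e) ≡ exponent e j
count-partsFrom i []      j       = refl
count-partsFrom i (n ∷ e) zero    = trans (count-++ i (partsFrom (suc i) e) _) (cong₂ ℕ._+_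
  (count-none (All.map (λ i<x → ℕ.<⇒≢ i<x) (partsFrom-≥ (suc i) e)))
  (count-replicate n i))
count-partsFrom i (n ∷ e) (suc j) = trans (count-++ (suc j ℕ.+ i) (partsFrom (suc i) e) _) (trans (cong₂ ℕ._+_
  (trans (cong (λ m → count m (partsFrom (suc i) e)) (sym (ℕ.+-suc j i))) (count-partsFrom (suc i) e j))
  (count-none (All.replicate⁺ n (λ eq → ℕ.<⇒≢ (s≤s (ℕ.m≤n+m i j)) (sym eq)))))
  (ℕ.+-identityʳ _))

count-large : ∀ m xs → sum xs < m → count m xs ≡ 0
count-large m []       _  = refl
count-large m (x ∷ xs) lt = trans
  (count-reject xs (λ m≡x → ℕ.<⇒≢ (ℕ.≤-<-trans (ℕ.m≤m+n x (sum xs)) lt) (sym m≡x)))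
  (count-large m xs (ℕ.≤-<-trans (ℕ.m≤n+m (sum xs) x) lt))

exponent-applyUpTo : ∀ (f : ℕ → ℕ) n → (∀ j → n ≤ j → f j ≡ 0) → ∀ j → exponent (applyUpTo f n) j ≡ f j
exponent-applyUpTo f zero    big j       = sym (big j z≤n)
exponent-applyUpTo f (suc n) big zero    = refl
exponent-applyUpTo f (suc n) big (suc j) = exponent-applyUpTo (f ∘ suc) n (λ j n≤j → big (suc j) (s≤s n≤j)) j

exponent-monomial : ∀ ν j → exponent (monomial ν) j ≡ r (suc j) ν
exponent-monomial ν = exponent-applyUpTo (λ i → r (suc i) ν) (size ν)
  λ j size≤j → count-large (suc j) (parts ν) (s≤s size≤j)

r-partition : ∀ e j → r (suc j) (partition e) ≡ exponent e j
r-partition e j = trans (cong (λ m → count m (partsFrom 1 e)) (ℕ.+-comm 1 j)) (count-partsFrom 1 e j)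

exponent-partition : ∀ e j → exponent (monomial (partition e)) j ≡ exponent e j
exponent-partition e j = trans (exponent-monomial (partition e) j) (r-partition e j)

coherent⇒ : ∀ {A : Set} (f : Monomial → A) → (∀ e → f (e ++ 0 ∷ []) ≡ f e) →
  ∀ e e′ → (∀ j → exponent e j ≡ exponent e′ j) → f e ≡ f e′
coherent⇒ f coh []      []       eq = refl
coherent⇒ f coh (n ∷ e) (m ∷ e′) eq with refl ← eq 0 =
  coherent⇒ (λ e → f (n ∷ e)) (λ e → coh (n ∷ e)) e e′ (eq ∘ suc)
coherent⇒ f coh []      (m ∷ e′) eq with refl ← eq 0 =
  trans (sym (coh [])) (coherent⇒ (λ e → f (0 ∷ e)) (λ e → coh (0 ∷ e)) [] e′ (eq ∘ suc))
coherent⇒ f coh (n ∷ e) []       eq with refl ← eq 0 =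
  trans (coherent⇒ (λ e → f (0 ∷ e)) (λ e → coh (0 ∷ e)) e [] (eq ∘ suc)) (coh [])

partsFrom-++0 : ∀ i e → partsFrom i (e ++ 0 ∷ []) ≡ partsFrom i e
partsFrom-++0 i []      = refl
partsFrom-++0 i (n ∷ e) = cong (_++ replicate n i) (partsFrom-++0 (suc i) e)

parts-injective : ∀ {ν ν′} → parts ν ≡ parts ν′ → ν ≡ ν′
parts-injective {mkPartition _ _ _} {mkPartition _ _ _} refl = refl

-- ∑_ν f(ν) u_{ν₁} u_{ν₂} ⋯: only ν = partition e contributes to the monomial e.
∑ν : (Partition → ℚ) → PowerSeries
coeff    (∑ν f) e = f (partition e)
coherent (∑ν f) e = cong f (parts-injective (partsFrom-++0 1 e))

⟪_⟫ : (Partition → ℚ) → PowerSeries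
⟪ f ⟫ = ∑ν f ⋆ (∑ν λ _ → 1ℚ) ⁻¹

-- ⟪ f ⊙ g ⟫ = ⟪ f ⟫ ⋆ ⟪ g ⟫ with the denominator of ⟪ f ⊙ g ⟫ cleared; by ⟪⟫-⊙ and
-- ⟪⟫-injective below, f ⊙ g is the unique function with this property.
infixl 7 _⊙_
_⊙_ : (Partition → ℚ) → (Partition → ℚ) → Partition → ℚ
(f ⊙ g) ν = coeff (⟪ f ⟫ ⋆ ⟪ g ⟫ ⋆ ∑ν λ _ → 1ℚ) (monomial ν)

⟪⟫-⊙ : ∀ f g → ⟪ f ⊙ g ⟫ ≈ ⟪ f ⟫ ⋆ ⟪ g ⟫
⟪⟫-⊙ f g e = begin
  coeff (∑ν (f ⊙ g) ⋆ D ⁻¹) e    ≡⟨ ⋆-cong (∑ν (f ⊙ g)) (P ⋆ D) (D ⁻¹) (D ⁻¹) ∑ν-⊙ (λ _ → refl) e ⟩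
  coeff ((P ⋆ D) ⋆ D ⁻¹) e       ≡⟨ ⋆-assoc P D (D ⁻¹) e ⟩
  coeff (P ⋆ (D ⋆ D ⁻¹)) e       ≡⟨ ⋆-cong P P (D ⋆ D ⁻¹) 𝟙 (λ _ → refl) (⋆-inverseʳ D refl) e ⟩
  coeff (P ⋆ 𝟙) e                ≡⟨ ⋆-identityʳ P e ⟩
  coeff P e                      ∎
  where
  open ≡-Reasoning
  D = ∑ν λ _ → 1ℚ
  P = ⟪ f ⟫ ⋆ ⟪ g ⟫
  ∑ν-⊙ : ∑ν (f ⊙ g) ≈ P ⋆ D
  ∑ν-⊙ e = coherent⇒ (coeff (P ⋆ D)) (coherent (P ⋆ D)) (monomial (partition e)) e (exponent-partition e)

count>0⇒≤ : ∀ {x y ys} → AllPairs _≥_ (y ∷ ys) → count x (y ∷ ys) ≢ 0 → x ≤ y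
count>0⇒≤ {x} {y} (y≥ys ∷ _) x∈ with ℕ.<-cmp x y
... | tri< x<y _    _   = ℕ.<⇒≤ x<y
... | tri≈ _   refl _   = ℕ.≤-refl
... | tri> _   _    y<x = ⊥-elim (x∈ (count-none
  ((λ x≡y → ℕ.<⇒≢ y<x (sym x≡y)) ∷ All.map (λ z≤y x≡z → ℕ.<⇒≢ (ℕ.≤-<-trans z≤y y<x) (sym x≡z)) y≥ys)))

count-head≢0 : ∀ x xs → count x (x ∷ xs) ≢ 0
count-head≢0 x xs rewrite count-accept x xs = λ ()

count-injective : ∀ {xs ys} → AllPairs _≥_ xs → AllPairs _≥_ ys → (∀ m → count m xs ≡ count m ys) → xs ≡ ys
count-injective {[]}     {[]}     _  _  eq = refl
count-injective {[]}     {y ∷ ys} _  _  eq = ⊥-elim (count-head≢0 y ys (sym (eq y)))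
count-injective {x ∷ xs} {[]}     _  _  eq = ⊥-elim (count-head≢0 x xs (eq x))
count-injective {x ∷ xs} {y ∷ ys} x↘ y↘ eq
  with refl ← ℕ.≤-antisym (count>0⇒≤ y↘ (λ z → count-head≢0 x xs (trans (eq x) z)))
                          (count>0⇒≤ x↘ (λ z → count-head≢0 y ys (trans (sym (eq y)) z))) =
  cong (x ∷_) (count-injective (AllPairs.tail x↘) (AllPairs.tail y↘) eq′)
  where
  eq′ : ∀ m → count m xs ≡ count m ys
  eq′ m with m ℕ.≟ x
  ... | yes refl = ℕ.suc-injective (trans (sym (count-accept x xs)) (trans (eq x) (count-accept x ys)))
  ... | no m≢x   = trans (sym (count-reject xs m≢x)) (trans (eq m) (count-reject ys m≢x))

partition-monomial : ∀ ν → partition (monomial ν) ≡ ν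
partition-monomial ν@(mkPartition xs xs↘ xs>0) = parts-injective
  (recompute (≡-dec ℕ._≟_ _ xs)
    (count-injective (partsFrom-decreasing 1 (monomial ν)) (Linked⇒AllPairs (flip ℕ.≤-trans) xs↘) (λ where
      zero    → trans (count-none (All.map ℕ.<⇒≢ (partsFrom-≥ 1 (monomial ν))))
                      (sym (count-none (All.map ℕ.<⇒≢ xs>0)))
      (suc j) → trans (r-partition (monomial ν) j) (exponent-monomial ν j))))

⟪⟫-injective : ∀ {f g} → ⟪ f ⟫ ≈ ⟪ g ⟫ → f ≗ g
⟪⟫-injective {f} {g} f≈g ν = begin
  f ν                              ≡⟨ cong f (partition-monomial ν) ⟨
  coeff (∑ν f) (monomial ν)        ≡⟨ cancel f (monomial ν) ⟨
  coeff (⟪ f ⟫ ⋆ D) (monomial ν)   ≡⟨ ⋆-cong ⟪ f ⟫ ⟪ g ⟫ D D f≈g (λ _ → refl) (monomial ν) ⟩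
  coeff (⟪ g ⟫ ⋆ D) (monomial ν)   ≡⟨ cancel g (monomial ν) ⟩
  coeff (∑ν g) (monomial ν)        ≡⟨ cong g (partition-monomial ν) ⟩
  g ν                              ∎
  where
  open ≡-Reasoning
  D = ∑ν λ _ → 1ℚ
  cancel : ∀ h → ⟪ h ⟫ ⋆ D ≈ ∑ν h
  cancel h e = begin
    coeff ((∑ν h ⋆ D ⁻¹) ⋆ D) e   ≡⟨ ⋆-assoc (∑ν h) (D ⁻¹) D e ⟩
    coeff (∑ν h ⋆ (D ⁻¹ ⋆ D)) e   ≡⟨ ⋆-cong (∑ν h) (∑ν h) (D ⁻¹ ⋆ D) 𝟙 (λ _ → refl)
                                       (λ e → trans (⋆-comm (D ⁻¹) D e) (⋆-inverseʳ D refl e)) e ⟩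
    coeff (∑ν h ⋆ 𝟙) e            ≡⟨ ⋆-identityʳ (∑ν h) e ⟩
    coeff (∑ν h) e                ∎

{-# OPTIONS --safe #-}

-- Clearing denominators turns f ⊙ g into the sum of f(α) g(β) over factorisations, weighted by
-- ∏ (1 - u_m). This is an expectation with respect to a signed measure of total mass 1 on pairs
-- (α , β), under which the multiplicities of different parts m are independent. Hence the
-- expectation of a product of generators, taken in α or in β, is a polynomial in its joint
-- cumulants, and each joint cumulant is a sum over m of cumulants of F_l(a) and F_l(b) for the two
-- multiplicities a + b ≤ r_m of the single part m.
--
-- The parity condition survives because of the reflection n ↦ -1 - n. Up to constants F_l has
-- parity l under it, and both the pointwise and the one-variable induced product respect it; on
-- normalised generating functions it is u ↦ 1/u. Adding constants to random variables changes
-- cumulants only by constants, so a cumulant of the F_l has a parity up to a constant, and it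
-- vanishes at r_m = 0. Therefore it is a combination of F_l with l of that parity, whose sums over
-- m belong to 𝒯.
module Submission where

open import Defs
open import Data.Bool.Base using (Bool; true; false; if_then_else_)
import Data.Integer.Base as ℤ
open import Data.List.Base as List using (List; []; _∷_; _++_; length)
open import Data.Nat.Base as ℕ using (ℕ; zero; suc; NonZero; _≤_; _<_; z≤n; s≤s; parity)
open import Data.Nat.Divisibility using (_∣_; divides)
import Data.Nat.Properties as ℕ
open import Data.Parity.Base as ℙ using (Parity; 0ℙ; 1ℙ)
import Data.Parity.Properties as ℙ
import Algebra.Properties.CommutativeSemigroup ℙ.+-commutativeSemigroup as ℙ-Semigroup
open import Data.Product.Base using (∃; _×_; _,_; proj₁; proj₂)
open import Data.Rational.Base using (ℚ; 0ℚ; 1ℚ; ½; _+_; _*_; _-_; -_; _/_)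
import Data.Rational.Properties as ℚ
import Data.Rational.Solver as ℚ-Solver
open import Data.Sum.Base using (_⊎_; inj₁; inj₂)
open import Data.Unit.Base using (⊤; tt)
open import Function.Base using (_∘_)
open import Level using (0ℓ)
open import Relation.Binary.PropositionalEquality
open import Relation.Unary using (Pred; _∈_)

private
  variable
    X Z I 𝔸 : Set

-- Linear functionals, subspaces and spans

record Linear (ℓ : (X → ℚ) → ℚ) : Set where
  field
    ≗-cong : ∀ {f g} → f ≗ g → ℓ f ≡ ℓ g
    +-homo : ∀ f g → ℓ (λ x → f x + g x) ≡ ℓ f + ℓ g
    *-homo : ∀ c f → ℓ (λ x → c * f x) ≡ c * ℓ f

  0-homo : ℓ (λ _ → 0ℚ) ≡ 0ℚ
  0-homo = trans (*-homo 0ℚ (λ _ → 0ℚ)) (ℚ.*-zeroˡ (ℓ (λ _ → 0ℚ)))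

  *-homoʳ : ∀ f c → ℓ (λ x → f x * c) ≡ ℓ f * c
  *-homoʳ f c = trans (≗-cong (λ x → ℚ.*-comm (f x) c)) (trans (*-homo c f) (ℚ.*-comm c _))

open Linear

linear-at : ∀ (x : X) → Linear (λ f → f x)
linear-at x = record { ≗-cong = λ eq → eq x ; +-homo = λ _ _ → refl ; *-homo = λ _ _ → refl }

linear-+ : ∀ {ℓ ℓ′ : (X → ℚ) → ℚ} → Linear ℓ → Linear ℓ′ → Linear (λ f → ℓ f + ℓ′ f)
linear-+ {ℓ = ℓ} {ℓ′} L L′ = record
  { ≗-cong = λ eq → cong₂ _+_ (≗-cong L eq) (≗-cong L′ eq)
  ; +-homo = λ f g → trans (cong₂ _+_ (+-homo L f g) (+-homo L′ f g))
      (solve 4 (λ a b c d → (a :+ b) :+ (c :+ d) := (a :+ c) :+ (b :+ d)) refl (ℓ f) (ℓ g) (ℓ′ f) (ℓ′ g))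
  ; *-homo = λ c f → trans (cong₂ _+_ (*-homo L c f) (*-homo L′ c f)) (sym (ℚ.*-distribˡ-+ c _ _))
  }
  where open ℚ-Solver.+-*-Solver

linear-* : ∀ {ℓ : (X → ℚ) → ℚ} d → Linear ℓ → Linear (λ f → d * ℓ f)
linear-* {ℓ = ℓ} d L = record
  { ≗-cong = λ eq → cong (d *_) (≗-cong L eq)
  ; +-homo = λ f g → trans (cong (d *_) (+-homo L f g)) (ℚ.*-distribˡ-+ d _ _)
  ; *-homo = λ c f → trans (cong (d *_) (*-homo L c f))
      (solve 3 (λ d c x → d :* (c :* x) := c :* (d :* x)) refl d c (ℓ f))
  }
  where open ℚ-Solver.+-*-Solver

linear-≗ : ∀ {ℓ ℓ′ : (X → ℚ) → ℚ} → (∀ f → ℓ f ≡ ℓ′ f) → Linear ℓ → Linear ℓ′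
linear-≗ eq L = record
  { ≗-cong = λ {f} {g} f≗g → trans (sym (eq f)) (trans (≗-cong L f≗g) (eq g))
  ; +-homo = λ f g → trans (sym (eq _)) (trans (+-homo L f g) (cong₂ _+_ (eq f) (eq g)))
  ; *-homo = λ c f → trans (sym (eq _)) (trans (*-homo L c f) (cong (c *_) (eq f)))
  }

linear-*ʳ : ∀ {ℓ : (X → ℚ) → ℚ} d → Linear ℓ → Linear (λ f → ℓ f * d)
linear-*ʳ {ℓ = ℓ} d L = linear-≗ (λ f → ℚ.*-comm d (ℓ f)) (linear-* d L)

linear-- : ∀ {ℓ ℓ′ : (X → ℚ) → ℚ} → Linear ℓ → Linear ℓ′ → Linear (λ f → ℓ f - ℓ′ f)
linear-- {ℓ = ℓ} {ℓ′} L L′ = linear-≗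
  (λ f → cong (ℓ f +_) (trans (sym (ℚ.neg-distribˡ-* 1ℚ (ℓ′ f))) (cong -_ (ℚ.*-identityˡ (ℓ′ f)))))
  (linear-+ L (linear-* (- 1ℚ) L′))

linear-∘ : ∀ {ℓ : (Z → ℚ) → ℚ} {A : (X → ℚ) → Z → ℚ} → Linear ℓ → (∀ z → Linear (λ f → A f z)) →
  Linear (λ f → ℓ (A f))
linear-∘ {A = A} L M = record
  { ≗-cong = λ eq → ≗-cong L (λ z → ≗-cong (M z) eq)
  ; +-homo = λ f g → trans (≗-cong L (λ z → +-homo (M z) f g)) (+-homo L (A f) (A g))
  ; *-homo = λ c f → trans (≗-cong L (λ z → *-homo (M z) c f)) (*-homo L c (A f))
  }

record IsSubspace (Q : Pred (X → ℚ) 0ℓ) : Set where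
  field
    0-closed : Q (λ _ → 0ℚ)
    +-closed : ∀ {f g} → Q f → Q g → Q (λ x → f x + g x)
    *-closed : ∀ c {f} → Q f → Q (λ x → c * f x)
    ≗-closed : ∀ {f g} → f ≗ g → Q f → Q g

  neg-closed : ∀ {f} → Q f → Q (λ x → - f x)
  neg-closed {f} f∈Q = ≗-closed
    (λ x → trans (sym (ℚ.neg-distribˡ-* 1ℚ (f x))) (cong -_ (ℚ.*-identityˡ (f x))))
    (*-closed (- 1ℚ) f∈Q)

open IsSubspace

data Span (b : I → X → ℚ) : Pred (X → ℚ) 0ℓ where
  basis  : ∀ i → Span b (b i)
  0-span : Span b (λ _ → 0ℚ)
  +-span : ∀ {f g} → Span b f → Span b g → Span b (λ x → f x + g x)
  *-span : ∀ c {f} → Span b f → Span b (λ x → c * f x)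
  ≗-span : ∀ {f g} → f ≗ g → Span b f → Span b g

span-isSubspace : ∀ (b : I → X → ℚ) → IsSubspace (Span b)
span-isSubspace b = record
  { 0-closed = 0-span ; +-closed = +-span ; *-closed = *-span ; ≗-closed = ≗-span }

-- Closure statements below are reduced to generators through this. `A` is a linear operator
-- presented pointwise, as a family of linear functionals indexed by `z`.
span-map : ∀ {b : I → X → ℚ} {Q : Pred (Z → ℚ) 0ℓ} → IsSubspace Q →
  {A : (X → ℚ) → Z → ℚ} → (∀ z → Linear (λ f → A f z)) →
  (∀ i → Q (A (b i))) → ∀ {f} → Span b f → Q (A f)
span-map S A-lin Ab (basis i)      = Ab i
span-map S A-lin Ab 0-span         = ≗-closed S (λ z → sym (0-homo (A-lin z))) (0-closed S)
span-map S A-lin Ab (+-span p q)   = ≗-closed S (λ z → sym (+-homo (A-lin z) _ _))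
  (+-closed S (span-map S A-lin Ab p) (span-map S A-lin Ab q))
span-map S A-lin Ab (*-span c p)   = ≗-closed S (λ z → sym (*-homo (A-lin z) c _))
  (*-closed S c (span-map S A-lin Ab p))
span-map S A-lin Ab (≗-span eq p)  = ≗-closed S (λ z → ≗-cong (A-lin z) eq) (span-map S A-lin Ab p)

-- The shuffle algebra of functions of words

-- Functions of words under the shuffle product: (f ∗ g) w is the sum of f u * g v over all ways
-- of distributing the letters of w to two subwords u and v.
∂ : 𝔸 → (List 𝔸 → ℚ) → List 𝔸 → ℚ
∂ x f w = f (x ∷ w)

infixl 7 _∗_
_∗_ : (List 𝔸 → ℚ) → (List 𝔸 → ℚ) → List 𝔸 → ℚ
(f ∗ g) []      = f [] * g []
(f ∗ g) (x ∷ w) = (∂ x f ∗ g) w + (f ∗ ∂ x g) w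

ε : List 𝔸 → ℚ
ε []      = 1ℚ
ε (_ ∷ _) = 0ℚ

∗-cong-≤ : ∀ {f f′ g g′ : List 𝔸 → ℚ} w →
  (∀ u → length u ≤ length w → f u ≡ f′ u) → (∀ u → length u ≤ length w → g u ≡ g′ u) →
  (f ∗ g) w ≡ (f′ ∗ g′) w
∗-cong-≤ []      f≡ g≡ = cong₂ _*_ (f≡ [] z≤n) (g≡ [] z≤n)
∗-cong-≤ (x ∷ w) f≡ g≡ = cong₂ _+_
  (∗-cong-≤ w (λ u u≤w → f≡ (x ∷ u) (s≤s u≤w)) (λ u u≤w → g≡ u (ℕ.m≤n⇒m≤1+n u≤w)))
  (∗-cong-≤ w (λ u u≤w → f≡ u (ℕ.m≤n⇒m≤1+n u≤w)) (λ u u≤w → g≡ (x ∷ u) (s≤s u≤w)))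

∗-cong : ∀ {f f′ g g′ : List 𝔸 → ℚ} → f ≗ f′ → g ≗ g′ → f ∗ g ≗ f′ ∗ g′
∗-cong f≗ g≗ w = ∗-cong-≤ w (λ u _ → f≗ u) (λ u _ → g≗ u)

-- The one term in which `f` receives all letters carries the factor `g []`, so `f` matters only on
-- strictly shorter words. This makes the recursion for the quotient well founded.
∗-cong-< : ∀ {f f′ g : List 𝔸 → ℚ} → g [] ≡ 0ℚ → ∀ w →
  (∀ u → length u < length w → f u ≡ f′ u) → (f ∗ g) w ≡ (f′ ∗ g) w
∗-cong-< {f = f} {f′} g[]≡0 [] f≡ rewrite g[]≡0 = trans (ℚ.*-zeroʳ (f [])) (sym (ℚ.*-zeroʳ (f′ [])))
∗-cong-< g[]≡0 (x ∷ w) f≡ = cong₂ _+_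
  (∗-cong-< g[]≡0 w (λ u u<w → f≡ (x ∷ u) (s≤s u<w)))
  (∗-cong-≤ w (λ u u≤w → f≡ u (s≤s u≤w)) (λ _ _ → refl))

∗-comm : ∀ (f g : List 𝔸 → ℚ) → f ∗ g ≗ g ∗ f
∗-comm f g []      = ℚ.*-comm (f []) (g [])
∗-comm f g (x ∷ w) = trans (cong₂ _+_ (∗-comm (∂ x f) g w) (∗-comm f (∂ x g) w))
  (ℚ.+-comm ((g ∗ ∂ x f) w) ((∂ x g ∗ f) w))

∗-linear : ∀ {ℓ : (X → ℚ) → ℚ} → Linear ℓ → ∀ (f : X → List 𝔸 → ℚ) (g : List 𝔸 → ℚ) w →
  ((λ u → ℓ (λ x → f x u)) ∗ g) w ≡ ℓ (λ x → (f x ∗ g) w)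
∗-linear L f g []      = sym (*-homoʳ L (λ x → f x []) (g []))
∗-linear L f g (a ∷ w) = trans
  (cong₂ _+_ (∗-linear L (λ x → ∂ a (f x)) g w) (∗-linear L f (∂ a g) w))
  (sym (+-homo L _ _))

∗-linearʳ : ∀ {ℓ : (X → ℚ) → ℚ} → Linear ℓ → ∀ (f : List 𝔸 → ℚ) (g : X → List 𝔸 → ℚ) w →
  (f ∗ (λ u → ℓ (λ x → g x u))) w ≡ ℓ (λ x → (f ∗ g x) w)
∗-linearʳ L f g w = trans (∗-comm f _ w)
  (trans (∗-linear L g f w) (≗-cong L (λ x → ∗-comm (g x) f w)))

∗-distribʳ : ∀ (f f′ g : List 𝔸 → ℚ) w → ((λ u → f u + f′ u) ∗ g) w ≡ (f ∗ g) w + (f′ ∗ g) w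
-- A sum of two terms is a linear functional of a family indexed by `Bool`.
∗-distribʳ f f′ g w = ∗-linear (linear-+ (linear-at true) (linear-at false)) (if_then f else f′) g w

∗-distribˡ : ∀ (f g g′ : List 𝔸 → ℚ) w → (f ∗ (λ u → g u + g′ u)) w ≡ (f ∗ g) w + (f ∗ g′) w
∗-distribˡ f g g′ w = ∗-linearʳ (linear-+ (linear-at true) (linear-at false)) f (if_then g else g′) w

∗-scaleˡ : ∀ c (f g : List 𝔸 → ℚ) w → ((λ u → c * f u) ∗ g) w ≡ c * (f ∗ g) w
∗-scaleˡ c f g w = ∗-linear (linear-* c (linear-at tt)) (λ _ → f) g w

∗-scaleʳ : ∀ c (f g : List 𝔸 → ℚ) w → (f ∗ (λ u → c * g u)) w ≡ c * (f ∗ g) w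
∗-scaleʳ c f g w = ∗-linearʳ (linear-* c (linear-at tt)) f (λ _ → g) w

∗-zeroˡ : ∀ (g : List 𝔸 → ℚ) w → ((λ _ → 0ℚ) ∗ g) w ≡ 0ℚ
∗-zeroˡ g w = trans (∗-scaleˡ 0ℚ (λ _ → 0ℚ) g w) (ℚ.*-zeroˡ (((λ _ → 0ℚ) ∗ g) w))

∗-identityˡ : ∀ (f : List 𝔸 → ℚ) → ε ∗ f ≗ f
∗-identityˡ f []      = ℚ.*-identityˡ (f [])
∗-identityˡ f (x ∷ w) = trans (cong₂ _+_ (∗-zeroˡ f w) (∗-identityˡ (∂ x f) w)) (ℚ.+-identityˡ _)

∗-identityʳ : ∀ (f : List 𝔸 → ℚ) → f ∗ ε ≗ f
∗-identityʳ f w = trans (∗-comm f ε w) (∗-identityˡ f w)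

-- Every `∂ x` is a derivation of `_∗_`, so both sides obey the same recursion on words.
∗-assoc : ∀ (f g h : List 𝔸 → ℚ) → (f ∗ g) ∗ h ≗ f ∗ (g ∗ h)
∗-assoc f g h []      = ℚ.*-assoc (f []) (g []) (h [])
∗-assoc f g h (x ∷ w) = begin
  ((λ u → (∂ x f ∗ g) u + (f ∗ ∂ x g) u) ∗ h) w + ((f ∗ g) ∗ ∂ x h) w
    ≡⟨ cong (_+ ((f ∗ g) ∗ ∂ x h) w) (∗-distribʳ (∂ x f ∗ g) (f ∗ ∂ x g) h w) ⟩
  ((∂ x f ∗ g) ∗ h) w + ((f ∗ ∂ x g) ∗ h) w + ((f ∗ g) ∗ ∂ x h) w
    ≡⟨ cong₂ _+_ (cong₂ _+_ (∗-assoc (∂ x f) g h w) (∗-assoc f (∂ x g) h w)) (∗-assoc f g (∂ x h) w) ⟩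
  (∂ x f ∗ (g ∗ h)) w + (f ∗ (∂ x g ∗ h)) w + (f ∗ (g ∗ ∂ x h)) w
    ≡⟨ ℚ.+-assoc ((∂ x f ∗ (g ∗ h)) w) _ _ ⟩
  (∂ x f ∗ (g ∗ h)) w + ((f ∗ (∂ x g ∗ h)) w + (f ∗ (g ∗ ∂ x h)) w)
    ≡⟨ cong ((∂ x f ∗ (g ∗ h)) w +_) (∗-distribˡ f (∂ x g ∗ h) (g ∗ ∂ x h) w) ⟨
  (∂ x f ∗ (g ∗ h)) w + (f ∗ (λ u → (∂ x g ∗ h) u + (g ∗ ∂ x h) u)) w ∎
  where open ≡-Reasoning

-- The quotient by g is the fixed point of q = f - q ∗ (g - ε).
module _ (f g : List 𝔸 → ℚ) where

  approximation : ℕ → List 𝔸 → ℚ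
  approximation zero    _ = 0ℚ
  approximation (suc k) w = f w - (approximation k ∗ (λ u → g u - ε u)) w

  quotient : List 𝔸 → ℚ
  quotient w = approximation (suc (length w)) w

  module _ (g[]≡1 : g [] ≡ 1ℚ) where

    private
      g-ε[]≡0 : g [] - ε {𝔸} [] ≡ 0ℚ
      g-ε[]≡0 = cong (_- 1ℚ) g[]≡1

    -- Since `g - ε` vanishes on the empty word, approximation `suc k` at a word uses approximation
    -- `k` only at shorter words. Hence the values at words shorter than the index are final.
    approximation-stable : ∀ k l w → length w < k → length w < l → approximation k w ≡ approximation l w
    approximation-stable (suc k) (suc l) w (s≤s w≤k) (s≤s w≤l) = cong (λ x → f w - x)
      (∗-cong-< g-ε[]≡0 w (λ u u<w →
        approximation-stable k l u (ℕ.<-≤-trans u<w w≤k) (ℕ.<-≤-trans u<w w≤l)))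

    quotient-∗ : quotient ∗ g ≗ f
    quotient-∗ w = begin
      (quotient ∗ g) w
        ≡⟨ ∗-cong {f = quotient} (λ _ → refl)
             (λ u → solve 2 (λ a b → a := b :+ (a :+ (:- b))) refl (g u) (ε u)) w ⟩
      (quotient ∗ (λ u → ε u + (g u - ε u))) w
        ≡⟨ ∗-distribˡ quotient ε (λ u → g u - ε u) w ⟩
      (quotient ∗ ε) w + (quotient ∗ (λ u → g u - ε u)) w
        ≡⟨ cong₂ _+_ (∗-identityʳ quotient w) (∗-cong-< g-ε[]≡0 w (λ u u<w →
             approximation-stable (suc (length u)) (length w) u ℕ.≤-refl u<w)) ⟩
      (f w - (approximation (length w) ∗ (λ u → g u - ε u)) w) + (approximation (length w) ∗ (λ u → g u - ε u)) w
        ≡⟨ solve 2 (λ a b → (a :+ (:- b)) :+ b := a) refl (f w) _ ⟩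
      f w ∎
      where
      open ≡-Reasoning
      open ℚ-Solver.+-*-Solver

-- Exponential and logarithm: moments and cumulants

-- μ = exp κ for the shuffle product, as a differential equation; κ [] is irrelevant. If μ is the
-- moment functional of random variables indexed by letters, then κ is its joint cumulant.
record IsExp (κ μ : List 𝔸 → ℚ) : Set where
  field
    empty      : μ [] ≡ 1ℚ
    derivative : ∀ x w → μ (x ∷ w) ≡ (∂ x κ ∗ μ) w

open IsExp

isExp-≗ : ∀ {κ κ′ μ μ′ : List 𝔸 → ℚ} → κ ≗ κ′ → μ ≗ μ′ → IsExp κ μ → IsExp κ′ μ′
isExp-≗ κ≗ μ≗ E = record
  { empty      = trans (sym (μ≗ [])) (empty E)
  ; derivative = λ x w → trans (sym (μ≗ (x ∷ w)))
      (trans (derivative E x w) (∗-cong (λ u → κ≗ (x ∷ u)) μ≗ w))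
  }

-- Cumulants of a sum of independent variables add: by the Leibniz rule the logarithmic derivative
-- of a product is the sum of the logarithmic derivatives.
isExp-∗ : ∀ {κ κ′ μ μ′ : List 𝔸 → ℚ} → IsExp κ μ → IsExp κ′ μ′ →
  IsExp (λ w → κ w + κ′ w) (μ ∗ μ′)
isExp-∗ {κ = κ} {κ′} {μ} {μ′} E E′ = record
  { empty      = trans (cong₂ _*_ (empty E) (empty E′)) (ℚ.*-identityˡ 1ℚ)
  ; derivative = λ x w → begin
      (∂ x μ ∗ μ′) w + (μ ∗ ∂ x μ′) w
        ≡⟨ cong₂ _+_ (∗-cong {g = μ′} (derivative E x) (λ _ → refl) w)
             (trans (∗-comm μ (∂ x μ′) w) (∗-cong {g = μ} (derivative E′ x) (λ _ → refl) w)) ⟩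
      ((∂ x κ ∗ μ) ∗ μ′) w + ((∂ x κ′ ∗ μ′) ∗ μ) w
        ≡⟨ cong₂ _+_ (∗-assoc (∂ x κ) μ μ′ w) (trans (∗-assoc (∂ x κ′) μ′ μ w)
             (∗-cong {f = ∂ x κ′} (λ _ → refl) (∗-comm μ′ μ) w)) ⟩
      (∂ x κ ∗ (μ ∗ μ′)) w + (∂ x κ′ ∗ (μ ∗ μ′)) w
        ≡⟨ ∗-distribʳ (∂ x κ) (∂ x κ′) (μ ∗ μ′) w ⟨
      ((λ u → ∂ x κ u + ∂ x κ′ u) ∗ (μ ∗ μ′)) w ∎
  }
  where open ≡-Reasoning

-- Dividing `∂ x μ` by `μ` gives the logarithmic derivative, which is `∂ x` of the cumulant.
logarithm : (List 𝔸 → ℚ) → List 𝔸 → ℚ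
logarithm μ []      = 0ℚ
logarithm μ (x ∷ w) = quotient (∂ x μ) μ w

isExp-logarithm : ∀ (μ : List 𝔸 → ℚ) → μ [] ≡ 1ℚ → IsExp (logarithm μ) μ
isExp-logarithm μ μ[]≡1 = record
  { empty      = μ[]≡1
  ; derivative = λ x w → sym (quotient-∗ (∂ x μ) μ μ[]≡1 w)
  }

isExp-ε⁻¹ : ∀ {κ μ : List 𝔸 → ℚ} → μ ≗ ε → IsExp κ μ → ∀ x w → κ (x ∷ w) ≡ 0ℚ
isExp-ε⁻¹ {κ = κ} μ≗ε E x w = begin
  κ (x ∷ w)        ≡⟨ ∗-identityʳ (∂ x κ) w ⟨
  (∂ x κ ∗ ε) w    ≡⟨ ∗-cong {f = ∂ x κ} (λ _ → refl) μ≗ε w ⟨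
  (∂ x κ ∗ _) w    ≡⟨ derivative E x w ⟨
  _                ≡⟨ μ≗ε (x ∷ w) ⟩
  0ℚ               ∎
  where open ≡-Reasoning

prod : (𝔸 → ℚ) → List 𝔸 → ℚ
prod z []      = 1ℚ
prod z (x ∷ w) = z x * prod z w

prod-cong : ∀ {z z′ : 𝔸 → ℚ} → z ≗ z′ → prod z ≗ prod z′
prod-cong eq []      = refl
prod-cong eq (x ∷ w) = cong₂ _*_ (eq x) (prod-cong eq w)

-- Multiplying out chooses one summand for each letter, which distributes the word to two subwords.
prod-+ : ∀ (z z′ : 𝔸 → ℚ) w → prod (λ x → z x + z′ x) w ≡ (prod z ∗ prod z′) w
prod-+ z z′ []      = sym (ℚ.*-identityˡ 1ℚ)
prod-+ z z′ (x ∷ w) = begin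
  (z x + z′ x) * prod (λ x → z x + z′ x) w
    ≡⟨ cong ((z x + z′ x) *_) (prod-+ z z′ w) ⟩
  (z x + z′ x) * (prod z ∗ prod z′) w
    ≡⟨ ℚ.*-distribʳ-+ ((prod z ∗ prod z′) w) (z x) (z′ x) ⟩
  z x * (prod z ∗ prod z′) w + z′ x * (prod z ∗ prod z′) w
    ≡⟨ cong₂ _+_ (∗-scaleˡ (z x) (prod z) (prod z′) w) (∗-scaleʳ (z′ x) (prod z) (prod z′) w) ⟨
  (∂ x (prod z) ∗ prod z′) w + (prod z ∗ ∂ x (prod z′)) w ∎
  where open ≡-Reasoning

prod-* : ∀ (z z′ : 𝔸 → ℚ) w → prod (λ x → z x * z′ x) w ≡ prod z w * prod z′ w
prod-* z z′ []      = sym (ℚ.*-identityˡ 1ℚ)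
prod-* z z′ (x ∷ w) = trans (cong (z x * z′ x *_) (prod-* z z′ w))
  (solve 4 (λ a b c d → (a :* b) :* (c :* d) := (a :* c) :* (b :* d)) refl (z x) (z′ x) (prod z w) (prod z′ w))
  where open ℚ-Solver.+-*-Solver

prod-∗ : ∀ (z : 𝔸 → ℚ) (f g : List 𝔸 → ℚ) w →
  ((λ u → prod z u * f u) ∗ (λ u → prod z u * g u)) w ≡ prod z w * (f ∗ g) w
prod-∗ z f g []      = trans (cong₂ _*_ (ℚ.*-identityˡ (f [])) (ℚ.*-identityˡ (g []))) (sym (ℚ.*-identityˡ _))
prod-∗ z f g (x ∷ w) = begin
  ((λ u → z x * prod z u * f (x ∷ u)) ∗ (λ u → prod z u * g u)) w +
  ((λ u → prod z u * f u) ∗ (λ u → z x * prod z u * g (x ∷ u))) w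
    ≡⟨ cong₂ _+_
         (trans (∗-cong {g = λ u → prod z u * g u} (λ u → ℚ.*-assoc (z x) (prod z u) _) (λ _ → refl) w)
           (trans (∗-scaleˡ (z x) (λ u → prod z u * ∂ x f u) (λ u → prod z u * g u) w)
             (cong (z x *_) (prod-∗ z (∂ x f) g w))))
         (trans (∗-cong {f = λ u → prod z u * f u} (λ _ → refl) (λ u → ℚ.*-assoc (z x) (prod z u) _) w)
           (trans (∗-scaleʳ (z x) (λ u → prod z u * f u) (λ u → prod z u * ∂ x g u) w)
             (cong (z x *_) (prod-∗ z f (∂ x g) w)))) ⟩
  z x * (prod z w * (∂ x f ∗ g) w) + z x * (prod z w * (f ∗ ∂ x g) w)
    ≡⟨ solve 4 (λ a b c d → a :* (b :* c) :+ a :* (b :* d) := a :* b :* (c :+ d)) refl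
         (z x) (prod z w) ((∂ x f ∗ g) w) ((f ∗ ∂ x g) w) ⟩
  z x * prod z w * ((∂ x f ∗ g) w + (f ∗ ∂ x g) w) ∎
  where
  open ≡-Reasoning
  open ℚ-Solver.+-*-Solver

-- Joint cumulants are homogeneous in each variable: a shuffle splits the letters of `w` between two
-- subwords, so the scalars multiply to `prod z w` in every term.
isExp-scale : ∀ (z : 𝔸 → ℚ) {κ μ : List 𝔸 → ℚ} → IsExp κ μ →
  IsExp (λ w → prod z w * κ w) (λ w → prod z w * μ w)
isExp-scale z {κ} {μ} E = record
  { empty      = trans (ℚ.*-identityˡ _) (empty E)
  ; derivative = λ x w → begin
      z x * prod z w * μ (x ∷ w)
        ≡⟨ cong (z x * prod z w *_) (derivative E x w) ⟩
      z x * prod z w * (∂ x κ ∗ μ) w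
        ≡⟨ ℚ.*-assoc (z x) (prod z w) _ ⟩
      z x * (prod z w * (∂ x κ ∗ μ) w)
        ≡⟨ cong (z x *_) (prod-∗ z (∂ x κ) μ w) ⟨
      z x * ((λ u → prod z u * ∂ x κ u) ∗ (λ u → prod z u * μ u)) w
        ≡⟨ ∗-scaleˡ (z x) (λ u → prod z u * ∂ x κ u) (λ u → prod z u * μ u) w ⟨
      ((λ u → z x * (prod z u * ∂ x κ u)) ∗ (λ u → prod z u * μ u)) w
        ≡⟨ ∗-cong {g = λ u → prod z u * μ u} (λ u → ℚ.*-assoc (z x) (prod z u) _) (λ _ → refl) w ⟨
      ((λ u → z x * prod z u * ∂ x κ u) ∗ (λ u → prod z u * μ u)) w ∎
  }
  where open ≡-Reasoning

-- The cumulants of constant random variables with values `z`: only first-order ones can be nonzero.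
onLetters : (𝔸 → ℚ) → List 𝔸 → ℚ
onLetters z (x ∷ [])    = z x
onLetters z []          = 0ℚ
onLetters z (_ ∷ _ ∷ _) = 0ℚ

∂-onLetters : ∀ (z : 𝔸 → ℚ) x w → onLetters z (x ∷ w) ≡ z x * ε w
∂-onLetters z x []      = sym (ℚ.*-identityʳ (z x))
∂-onLetters z x (_ ∷ _) = sym (ℚ.*-zeroʳ (z x))

isExp-prod : ∀ (z : 𝔸 → ℚ) → IsExp (onLetters z) (prod z)
isExp-prod z = record
  { empty      = refl
  ; derivative = λ x w → begin
      z x * prod z w                        ≡⟨ cong (z x *_) (∗-identityˡ (prod z) w) ⟨
      z x * (ε ∗ prod z) w                  ≡⟨ ∗-scaleˡ (z x) ε (prod z) w ⟨
      ((λ u → z x * ε u) ∗ prod z) w        ≡⟨ ∗-cong {g = prod z} (∂-onLetters z x) (λ _ → refl) w ⟨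
      (∂ x (onLetters z) ∗ prod z) w        ∎
  }
  where open ≡-Reasoning

-- Parity-graded algebras

-- The two pieces may coincide. This covers `Reflective` as well as `𝒯°` with a constant grading.
record IsGradedAlgebra (𝒢 : Parity → Pred (X → ℚ) 0ℓ) : Set where
  field
    isSubspace : ∀ p → IsSubspace (𝒢 p)
    1-closed   : 𝒢 0ℙ (λ _ → 1ℚ)
    ·-closed   : ∀ {p q f g} → 𝒢 p f → 𝒢 q g → 𝒢 (p ℙ.+ q) (λ x → f x * g x)

open IsGradedAlgebra

module _ (deg : 𝔸 → Parity) where

  wordDegree : List 𝔸 → Parity
  wordDegree []      = 0ℙ
  wordDegree (x ∷ w) = deg x ℙ.+ wordDegree w

  module _ {𝒢 : Parity → Pred (X → ℚ) 0ℓ} (G : IsGradedAlgebra 𝒢) where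

    ε-graded : ∀ w → 𝒢 (wordDegree w) (λ _ → ε w)
    ε-graded []      = 1-closed G
    ε-graded (_ ∷ _) = 0-closed (isSubspace G _)

    -- The offsets `p` and `q` absorb the degree of a letter each time `∂ a` is applied to a factor.
    -- The bounds on `length u` allow use inside an induction on word length.
    ∗-graded : ∀ p q (f g : X → List 𝔸 → ℚ) w →
      (∀ u → length u ≤ length w → 𝒢 (p ℙ.+ wordDegree u) (λ x → f x u)) →
      (∀ u → length u ≤ length w → 𝒢 (q ℙ.+ wordDegree u) (λ x → g x u)) →
      𝒢 (p ℙ.+ q ℙ.+ wordDegree w) (λ x → (f x ∗ g x) w)
    ∗-graded p q f g [] f∈𝒢 g∈𝒢 = subst (λ s → 𝒢 s _)
      (trans (cong₂ ℙ._+_ (ℙ.+-identityʳ p) (ℙ.+-identityʳ q)) (sym (ℙ.+-identityʳ (p ℙ.+ q))))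
      (·-closed G (f∈𝒢 [] z≤n) (g∈𝒢 [] z≤n))
    ∗-graded p q f g (a ∷ w) f∈𝒢 g∈𝒢 = +-closed (isSubspace G _)
      (subst (λ s → 𝒢 s _)
        (trans (cong (ℙ._+ wordDegree w) (ℙ-Semigroup.xy∙z≈xz∙y p (deg a) q)) (ℙ.+-assoc (p ℙ.+ q) (deg a) _))
        (∗-graded (p ℙ.+ deg a) q (λ x → ∂ a (f x)) g w
          (λ u u≤w → subst (λ s → 𝒢 s _) (sym (ℙ.+-assoc p (deg a) _)) (f∈𝒢 (a ∷ u) (s≤s u≤w)))
          (λ u u≤w → g∈𝒢 u (ℕ.m≤n⇒m≤1+n u≤w))))
      (subst (λ s → 𝒢 s _)
        (trans (cong (ℙ._+ wordDegree w) (sym (ℙ.+-assoc p q (deg a)))) (ℙ.+-assoc (p ℙ.+ q) (deg a) _))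
        (∗-graded p (q ℙ.+ deg a) f (λ x → ∂ a (g x)) w
          (λ u u≤w → f∈𝒢 u (ℕ.m≤n⇒m≤1+n u≤w))
          (λ u u≤w → subst (λ s → 𝒢 s _) (sym (ℙ.+-assoc q (deg a) _)) (g∈𝒢 (a ∷ u) (s≤s u≤w)))))

    logarithm-graded : ∀ (μ : X → List 𝔸 → ℚ) → (∀ w → 𝒢 (wordDegree w) (λ x → μ x w)) →
      ∀ w → 𝒢 (wordDegree w) (λ x → logarithm (μ x) w)
    logarithm-graded μ μ∈𝒢 []      = 0-closed (isSubspace G 0ℙ)
    logarithm-graded μ μ∈𝒢 (a ∷ w) = go (suc (length w)) w
      where
      go : ∀ k w → 𝒢 (deg a ℙ.+ wordDegree w) (λ x → approximation (∂ a (μ x)) (μ x) k w)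
      go zero    w = 0-closed (isSubspace G _)
      go (suc k) w = +-closed (isSubspace G _) (μ∈𝒢 (a ∷ w)) (neg-closed (isSubspace G _)
        (subst (λ s → 𝒢 (s ℙ.+ wordDegree w) _) (ℙ.+-identityʳ (deg a))
          (∗-graded (deg a) 0ℙ _ (λ x u → μ x u - ε u) w (λ u _ → go k u)
            (λ u _ → +-closed (isSubspace G _) (μ∈𝒢 u) (neg-closed (isSubspace G _) (ε-graded u))))))

-- Polynomials in one multiplicity and the reflection

fromℕ-suc : ∀ n → fromℕ (suc n) ≡ 1ℚ + fromℕ n
fromℕ-suc = fromℕ-+ 1

partialSum : (ℕ → ℚ) → ℕ → ℚ
partialSum f zero    = 0ℚ
partialSum f (suc n) = partialSum f n + f n

partialSum-linear : ∀ n → Linear (λ f → partialSum f n)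
partialSum-linear zero    = record
  { ≗-cong = λ _ → refl ; +-homo = λ _ _ → refl ; *-homo = λ c _ → sym (ℚ.*-zeroʳ c) }
partialSum-linear (suc n) = linear-+ (partialSum-linear n) (linear-at n)

-- In generating functions normalised by the factor 1 - u, halfSum is multiplication by
-- y = (1 + u) / 2(1 - u), which changes sign under u ↦ 1/u.
halfSum : (ℕ → ℚ) → ℕ → ℚ
halfSum f n = ½ * f n + partialSum f n

halfSum-linear : ∀ n → Linear (λ f → halfSum f n)
halfSum-linear n = linear-+ (linear-* ½ (linear-at n)) (partialSum-linear n)

-- The reflection n ↦ -1 - n, which corresponds to u ↦ 1/u, changes the sign of n + 1/2.
centred : ℕ → ℚ
centred n = fromℕ n + ½

-- Summation by parts: from `n` to `suc n` the left side grows by `centred n * f n + halfSum f n`.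
*-partialSum : ∀ (f : ℕ → ℚ) n →
  fromℕ n * partialSum f n ≡ partialSum (λ i → centred i * f i) n + partialSum (halfSum f) n
*-partialSum f zero    = refl
*-partialSum f (suc n) = begin
  fromℕ (suc n) * (s + f n)
    ≡⟨ cong (_* (s + f n)) (fromℕ-suc n) ⟩
  (1ℚ + fromℕ n) * (s + f n)
    ≡⟨ solve 3 (λ n s f → (con 1ℚ :+ n) :* (s :+ f) := n :* s :+ ((n :+ con ½) :* f :+ (con ½ :* f :+ s))) refl (fromℕ n) s (f n) ⟩
  fromℕ n * s + (centred n * f n + halfSum f n)
    ≡⟨ cong (_+ (centred n * f n + halfSum f n)) (*-partialSum f n) ⟩
  (p + q) + (centred n * f n + halfSum f n)
    ≡⟨ solve 4 (λ a b c d → (a :+ b) :+ (c :+ d) := (a :+ c) :+ (b :+ d)) refl p q (centred n * f n) (halfSum f n) ⟩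
  (p + centred n * f n) + (q + halfSum f n) ∎
  where
  open ≡-Reasoning
  open ℚ-Solver.+-*-Solver
  s = partialSum f n
  p = partialSum (λ i → centred i * f i) n
  q = partialSum (halfSum f) n

-- The Leibniz rule for u d/du on a product with y: the last two terms come from the derivative y² -
-- 1/4 of y.
centred-halfSum : ∀ (f : ℕ → ℚ) n →
  centred n * halfSum f n ≡ halfSum (λ i → centred i * f i) n + halfSum (halfSum f) n - ½ * ½ * f n
centred-halfSum f n = begin
  (fromℕ n + ½) * (½ * f n + s)
    ≡⟨ solve 3 (λ n f s → (n :+ con ½) :* (con ½ :* f :+ s) :=
         n :* s :+ (con ½ :* n :* f :+ con (½ * ½) :* f :+ con ½ :* s)) refl (fromℕ n) (f n) s ⟩
  fromℕ n * s + (½ * fromℕ n * f n + ½ * ½ * f n + ½ * s)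
    ≡⟨ cong (_+ (½ * fromℕ n * f n + ½ * ½ * f n + ½ * s)) (*-partialSum f n) ⟩
  p + q + (½ * fromℕ n * f n + ½ * ½ * f n + ½ * s)
    ≡⟨ solve 5 (λ p q n f s → p :+ q :+ (con ½ :* n :* f :+ con (½ * ½) :* f :+ con ½ :* s) :=
         (con ½ :* ((n :+ con ½) :* f) :+ p) :+ (con ½ :* (con ½ :* f :+ s) :+ q) :+ (:- (con (½ * ½) :* f)))
         refl p q (fromℕ n) (f n) s ⟩
  halfSum (λ i → centred i * f i) n + halfSum (halfSum f) n - ½ * ½ * f n ∎
  where
  open ≡-Reasoning
  open ℚ-Solver.+-*-Solver
  s = partialSum f n
  p = partialSum (λ i → centred i * f i) n
  q = partialSum (halfSum f) n

-- The function of `n` with normalised generating function y^j; for `j = 0` this is (1 - u) ∑ u^n =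
-- 1.
y^ : ℕ → ℕ → ℚ
y^ zero    = λ _ → 1ℚ
y^ (suc j) = halfSum (y^ j)

partialSum-1 : ∀ n → partialSum (λ _ → 1ℚ) n ≡ fromℕ n
partialSum-1 zero    = refl
partialSum-1 (suc n) = trans (cong (_+ 1ℚ) (partialSum-1 n)) (trans (ℚ.+-comm (fromℕ n) 1ℚ) (sym (fromℕ-suc n)))

y^1≡centred : ∀ n → y^ 1 n ≡ centred n
y^1≡centred n = trans (cong (½ +_) (partialSum-1 n)) (ℚ.+-comm ½ (fromℕ n))

-- (n + 1/2) acts as the operator u d/du + y on normalised generating functions, and u dy/du = y² - 1/4.
centred-y^ : ∀ j n → centred n * y^ (suc j) n ≡
  fromℕ (suc (suc j)) * y^ (suc (suc j)) n - ½ * ½ * fromℕ (suc j) * y^ j n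
centred-y^ zero n = begin
  centred n * y^ 1 n
    ≡⟨ centred-halfSum (y^ 0) n ⟩
  halfSum (λ i → centred i * 1ℚ) n + y^ 2 n - ½ * ½ * 1ℚ
    ≡⟨ cong (λ x → x + y^ 2 n - ½ * ½ * 1ℚ) (≗-cong (halfSum-linear n)
         (λ i → trans (ℚ.*-identityʳ (centred i)) (sym (y^1≡centred i)))) ⟩
  y^ 2 n + y^ 2 n - ½ * ½ * 1ℚ
    ≡⟨ solve 1 (λ y → y :+ y :+ (:- con (½ * ½ * 1ℚ)) := con (fromℕ 2) :* y :+ (:- con (½ * ½ * 1ℚ))) refl (y^ 2 n) ⟩
  fromℕ 2 * y^ 2 n - ½ * ½ * 1ℚ ∎
  where
  open ≡-Reasoning
  open ℚ-Solver.+-*-Solver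
centred-y^ (suc j) n = begin
  centred n * y^ (suc (suc j)) n
    ≡⟨ centred-halfSum (y^ (suc j)) n ⟩
  halfSum (λ i → centred i * y^ (suc j) i) n + y₃ - ½ * ½ * y₁
    ≡⟨ cong (λ x → x + y₃ - ½ * ½ * y₁) (≗-cong (halfSum-linear n) (centred-y^ j)) ⟩
  halfSum (λ i → c * y^ (suc (suc j)) i - d * y^ j i) n + y₃ - ½ * ½ * y₁
    ≡⟨ cong (λ x → x + y₃ - ½ * ½ * y₁) (trans
         (≗-cong (halfSum-linear n) (λ i → cong (c * y^ (suc (suc j)) i +_) (ℚ.neg-distribˡ-* d (y^ j i))))
         (trans (+-homo (halfSum-linear n) (λ i → c * y^ (suc (suc j)) i) (λ i → - d * y^ j i))
           (cong₂ _+_ (*-homo (halfSum-linear n) c (y^ (suc (suc j)))) (*-homo (halfSum-linear n) (- d) (y^ j))))) ⟩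
  c * y₃ + - d * y₁ + y₃ - ½ * ½ * y₁
    ≡⟨ solve 4 (λ c e y₃ y₁ → c :* y₃ :+ (:- (con (½ * ½) :* e)) :* y₁ :+ y₃ :+ (:- (con (½ * ½) :* y₁)) :=
         (con 1ℚ :+ c) :* y₃ :+ (:- (con (½ * ½) :* (con 1ℚ :+ e) :* y₁))) refl c e y₃ y₁ ⟩
  (1ℚ + c) * y₃ - ½ * ½ * (1ℚ + e) * y₁
    ≡⟨ cong₂ (λ c e → c * y₃ - ½ * ½ * e * y₁) (fromℕ-suc (suc (suc j))) (fromℕ-suc (suc j)) ⟨
  fromℕ (suc (suc (suc j))) * y₃ - ½ * ½ * fromℕ (suc (suc j)) * y₁ ∎
  where
  open ≡-Reasoning
  open ℚ-Solver.+-*-Solver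
  c  = fromℕ (suc (suc j))
  e  = fromℕ (suc j)
  d  = ½ * ½ * e
  y₁ = y^ (suc j) n
  y₃ = y^ (suc (suc (suc j))) n

parity-suc : ∀ n → parity (suc n) ≡ 1ℙ ℙ.+ parity n
parity-suc n = trans (sym (ℙ.⁻¹-involutive (parity (suc n)))) (cong ℙ._⁻¹ (ℙ.suc-homo-⁻¹ n))

-- Polynomials in n that are even or odd under n ↦ -1 - n
Reflective : Parity → Pred (ℕ → ℚ) 0ℓ
Reflective p = Span {I = ∃ λ j → parity j ≡ p} (λ (j , _) → y^ j)

reflective-isSubspace : ∀ p → IsSubspace (Reflective p)
reflective-isSubspace p = span-isSubspace _

reflective-cast : ∀ {p q f} → p ≡ q → Reflective p f → Reflective q f
reflective-cast refl f∈ = f∈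

reflective-y^ : ∀ j → Reflective (parity j) (y^ j)
reflective-y^ j = basis (j , refl)

halfSum-reflective : ∀ {p f} → Reflective p f → Reflective (1ℙ ℙ.+ p) (halfSum f)
halfSum-reflective = span-map (reflective-isSubspace _) halfSum-linear
  λ { (j , refl) → basis (suc j , parity-suc j) }

pointwise-linear : ∀ (g : X → ℚ) x → Linear (λ f → g x * f x)
pointwise-linear g x = linear-* (g x) (linear-at x)

centred-reflective : ∀ {p f} → Reflective p f → Reflective (1ℙ ℙ.+ p) (λ n → centred n * f n)
centred-reflective = span-map (reflective-isSubspace _) (pointwise-linear centred) λ where
  (zero , refl) → ≗-span (λ n → trans (y^1≡centred n) (sym (ℚ.*-identityʳ (centred n)))) (reflective-y^ 1)
  (suc j , refl) → ≗-span (λ n → sym (centred-y^ j n)) (reflective-cast (sym (ℙ.suc-homo-⁻¹ j))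
    (+-closed (reflective-isSubspace (parity j)) (*-span (fromℕ (suc (suc j))) (reflective-y^ (suc (suc j))))
      (neg-closed (reflective-isSubspace (parity j)) (*-span (½ * ½ * fromℕ (suc j)) (reflective-y^ j)))))

-- Solving `centred-y^` for its highest power replaces `halfSum` by pointwise multiplication with
-- `centred`. Pointwise products with `y^ j` then follow by induction on `j`.
y^-step : ∀ j n → y^ (suc (suc j)) n ≡
  (ℤ.+ 1 / suc (suc j)) * (centred n * y^ (suc j) n + ½ * ½ * fromℕ (suc j) * y^ j n)
y^-step j n = sym (begin
  i * (centred n * y^ (suc j) n + d)
    ≡⟨ cong (λ x → i * (x + d)) (centred-y^ j n) ⟩
  i * (c * y^ (suc (suc j)) n - d + d)
    ≡⟨ solve 4 (λ i c y d → i :* (c :* y :+ (:- d) :+ d) := i :* c :* y) refl i c (y^ (suc (suc j)) n) d ⟩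
  i * c * y^ (suc (suc j)) n
    ≡⟨ trans (cong (_* y^ (suc (suc j)) n) (1/suc (suc j))) (ℚ.*-identityˡ _) ⟩
  y^ (suc (suc j)) n ∎)
  where
  open ≡-Reasoning
  open ℚ-Solver.+-*-Solver
  i = ℤ.+ 1 / suc (suc j)
  c = fromℕ (suc (suc j))
  d = ½ * ½ * fromℕ (suc j) * y^ j n

y^-·-reflective : ∀ j {q g} → Reflective q g → Reflective (parity j ℙ.+ q) (λ n → y^ j n * g n)
y^-·-reflective zero          g∈ = ≗-span (λ n → sym (ℚ.*-identityˡ _)) g∈
y^-·-reflective (suc zero)    {g = g} g∈ = ≗-span (λ n → cong (_* g n) (sym (y^1≡centred n))) (centred-reflective g∈)
y^-·-reflective (suc (suc j)) {q} {g} g∈ = ≗-span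
  (λ n → trans
    (solve 6 (λ i c y d z g → i :* (c :* (y :* g) :+ d :* (z :* g)) := i :* (c :* y :+ d :* z) :* g) refl
      (ℤ.+ 1 / suc (suc j)) (centred n) (y^ (suc j) n) (½ * ½ * fromℕ (suc j)) (y^ j n) (g n))
    (cong (_* g n) (sym (y^-step j n))))
  (*-span (ℤ.+ 1 / suc (suc j)) (+-span
    (reflective-cast
      (trans (sym (ℙ.+-assoc 1ℙ (parity (suc j)) q)) (cong (ℙ._+ q) (ℙ.suc-homo-⁻¹ j)))
      (centred-reflective (y^-·-reflective (suc j) g∈)))
    (*-span (½ * ½ * fromℕ (suc j)) (y^-·-reflective j g∈))))
  where open ℚ-Solver.+-*-Solver

reflective-isGradedAlgebra : IsGradedAlgebra Reflective
reflective-isGradedAlgebra = record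
  { isSubspace = reflective-isSubspace
  ; 1-closed   = reflective-y^ 0
  ; ·-closed   = λ {p} {q} {f} {g} f∈ g∈ → span-map (reflective-isSubspace (p ℙ.+ q))
      (λ n → linear-*ʳ (g n) (linear-at n))
      (λ { (j , refl) → y^-·-reflective j g∈ }) f∈
  }

-- The induced product in one variable

antidiagonal-linear : ∀ n → Linear (λ (φ : ℕ × ℕ → ℚ) → antidiagonal n (λ a b → φ (a , b)))
antidiagonal-linear n = record
  { ≗-cong = λ eq → antidiagonal-cong n (λ a b _ → eq (a , b))
  ; +-homo = λ φ ψ → antidiagonal-+ n (λ a b → φ (a , b)) (λ a b → ψ (a , b))
  ; *-homo = λ c φ → antidiagonal-* n c (λ a b → φ (a , b))
  }

-- The coefficient of u^n in (1 - u) ∑ φ(a , b) u^(a + b)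
mean : ℕ → (ℕ × ℕ → ℚ) → ℚ
mean zero    φ = φ (0 , 0)
mean (suc n) φ = antidiagonal (suc n) (λ a b → φ (a , b)) - antidiagonal n (λ a b → φ (a , b))

mean-linear : ∀ n → Linear (mean n)
mean-linear zero    = linear-at (0 , 0)
mean-linear (suc n) = linear-- (antidiagonal-linear (suc n)) (antidiagonal-linear n)

mean-const : ∀ (g : ℕ → ℚ) n → mean n (λ (a , b) → 1ℚ * g b) ≡ g n
mean-const g zero    = ℚ.*-identityˡ (g 0)
mean-const g (suc n) = solve 2 (λ g x → con 1ℚ :* g :+ x :+ (:- x) := g) refl (g (suc n)) (antidiagonal n (λ a b → 1ℚ * g b))
  where open ℚ-Solver.+-*-Solver

antidiagonal-partialSum : ∀ (f g : ℕ → ℚ) n → antidiagonal n (λ a b → partialSum f a * g b) ≡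
  partialSum (λ m → antidiagonal m (λ a b → f a * g b)) n
antidiagonal-partialSum f g zero    = ℚ.*-zeroˡ (g 0)
antidiagonal-partialSum f g (suc n) = begin
  0ℚ * g (suc n) + antidiagonal n (λ a b → (partialSum f a + f a) * g b)
    ≡⟨ trans (cong (_+ rest) (ℚ.*-zeroˡ (g (suc n)))) (ℚ.+-identityˡ rest) ⟩
  antidiagonal n (λ a b → (partialSum f a + f a) * g b)
    ≡⟨ antidiagonal-cong n (λ a b _ → ℚ.*-distribʳ-+ (g b) (partialSum f a) (f a)) ⟩
  antidiagonal n (λ a b → partialSum f a * g b + f a * g b)
    ≡⟨ antidiagonal-+ n (λ a b → partialSum f a * g b) (λ a b → f a * g b) ⟩
  antidiagonal n (λ a b → partialSum f a * g b) + antidiagonal n (λ a b → f a * g b)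
    ≡⟨ cong (_+ antidiagonal n (λ a b → f a * g b)) (antidiagonal-partialSum f g n) ⟩
  partialSum (λ m → antidiagonal m (λ a b → f a * g b)) n + antidiagonal n (λ a b → f a * g b) ∎
  where
  open ≡-Reasoning
  rest = antidiagonal n (λ a b → (partialSum f a + f a) * g b)

partialSum-mean : ∀ φ n → partialSum (λ m → mean m φ) (suc n) ≡ antidiagonal n (λ a b → φ (a , b))
partialSum-mean φ zero    = ℚ.+-identityˡ _
partialSum-mean φ (suc n) = trans (cong (_+ mean (suc n) φ) (partialSum-mean φ n))
  (solve 2 (λ a b → a :+ (b :+ (:- a)) := b) refl
    (antidiagonal n (λ a b → φ (a , b))) (antidiagonal (suc n) (λ a b → φ (a , b))))
  where open ℚ-Solver.+-*-Solver

mean-partialSum : ∀ (f g : ℕ → ℚ) n → mean n (λ (a , b) → partialSum f a * g b) ≡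
  partialSum (λ m → mean m (λ (a , b) → f a * g b)) n
mean-partialSum f g zero    = ℚ.*-zeroˡ (g 0)
mean-partialSum f g (suc n) = begin
  antidiagonal (suc n) (λ a b → partialSum f a * g b) - antidiagonal n (λ a b → partialSum f a * g b)
    ≡⟨ cong₂ _-_ (antidiagonal-partialSum f g (suc n)) (antidiagonal-partialSum f g n) ⟩
  (partialSum c n + c n) - partialSum c n
    ≡⟨ solve 2 (λ a b → a :+ b :+ (:- a) := b) refl (partialSum c n) (c n) ⟩
  c n
    ≡⟨ partialSum-mean (λ (a , b) → f a * g b) n ⟨
  partialSum (λ m → mean m (λ (a , b) → f a * g b)) (suc n) ∎
  where
  open ≡-Reasoning
  open ℚ-Solver.+-*-Solver
  c : ℕ → ℚ
  c m = antidiagonal m (λ a b → f a * g b)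

-- On normalised generating functions `mean` multiplies the series of `f` and `g`, so the factor y
-- of one of them can be pulled out.
mean-halfSum : ∀ (f g : ℕ → ℚ) n → mean n (λ (a , b) → halfSum f a * g b) ≡
  halfSum (λ m → mean m (λ (a , b) → f a * g b)) n
mean-halfSum f g n = begin
  mean n (λ (a , b) → (½ * f a + partialSum f a) * g b)
    ≡⟨ ≗-cong (mean-linear n) (λ (a , b) →
         solve 3 (λ f s g → (con ½ :* f :+ s) :* g := con ½ :* (f :* g) :+ s :* g) refl (f a) (partialSum f a) (g b)) ⟩
  mean n (λ (a , b) → ½ * (f a * g b) + partialSum f a * g b)
    ≡⟨ +-homo (mean-linear n) (λ (a , b) → ½ * (f a * g b)) (λ (a , b) → partialSum f a * g b) ⟩
  mean n (λ (a , b) → ½ * (f a * g b)) + mean n (λ (a , b) → partialSum f a * g b)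
    ≡⟨ cong₂ _+_ (*-homo (mean-linear n) ½ (λ (a , b) → f a * g b)) (mean-partialSum f g n) ⟩
  halfSum (λ m → mean m (λ (a , b) → f a * g b)) n ∎
  where
  open ≡-Reasoning
  open ℚ-Solver.+-*-Solver

mean-reflective : ∀ {p q f g} → Reflective p f → Reflective q g →
  Reflective (p ℙ.+ q) (λ n → mean n (λ (a , b) → f a * g b))
mean-reflective {p} {q} {g = g} f∈ g∈ = span-map (reflective-isSubspace (p ℙ.+ q))
  (λ n → linear-∘ (mean-linear n) (λ (a , b) → linear-*ʳ (g b) (linear-at a)))
  (λ { (j , refl) → y^-mean j }) f∈
  where
  y^-mean : ∀ j → Reflective (parity j ℙ.+ q) (λ n → mean n (λ (a , b) → y^ j a * g b))
  y^-mean zero    = ≗-span (λ n → sym (mean-const g n)) g∈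
  y^-mean (suc j) = ≗-span (λ n → sym (mean-halfSum (y^ j) g n)) (reflective-cast
    (trans (sym (ℙ.+-assoc 1ℙ (parity j) q)) (cong (ℙ._+ q) (sym (parity-suc j))))
    (halfSum-reflective (y^-mean j)))

-- Faulhaber polynomials under the reflection

-- F_{l + 1}
powerSum : ℕ → ℕ → ℚ
powerSum l n = ∑₁ n (λ i → fromℕ (i ℕ.^ l))

-- On normalised generating functions this is u d/du.
D : (ℕ → ℚ) → ℕ → ℚ
D f n = centred n * f n - halfSum f n

D-linear : ∀ n → Linear (λ f → D f n)
D-linear n = linear-- (pointwise-linear centred n) (halfSum-linear n)

D-1 : ∀ n → D (λ _ → 1ℚ) n ≡ 0ℚ
D-1 n = trans (cong₂ _-_ (ℚ.*-identityʳ (centred n)) (y^1≡centred n)) (ℚ.+-inverseʳ (centred n))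

-- Abel summation: `D f n` is `fromℕ n * f n - partialSum f n`, which for `f 0 = 0` is the sum of i
-- (f(i) - f(i - 1)) over i ≤ n. The differences of `powerSum l` are i^l.
D-powerSum : ∀ l n → D (powerSum l) n ≡ powerSum (suc l) n
D-powerSum l n = trans
  (solve 3 (λ n f s → (n :+ con ½) :* f :+ (:- (con ½ :* f :+ s)) := n :* f :+ (:- s)) refl
    (fromℕ n) (powerSum l n) (partialSum (powerSum l) n))
  (go n)
  where
  open ≡-Reasoning
  open ℚ-Solver.+-*-Solver
  go : ∀ n → fromℕ n * powerSum l n - partialSum (powerSum l) n ≡ powerSum (suc l) n
  go zero    = refl
  go (suc n) = begin
    fromℕ (suc n) * (f + x) - (s + f)
      ≡⟨ cong (λ m → m * (f + x) - (s + f)) (fromℕ-suc n) ⟩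
    (1ℚ + fromℕ n) * (f + x) - (s + f)
      ≡⟨ solve 4 (λ n f x s → (con 1ℚ :+ n) :* (f :+ x) :+ (:- (s :+ f)) := n :* f :+ (:- s) :+ (con 1ℚ :+ n) :* x) refl
           (fromℕ n) f x s ⟩
    fromℕ n * f - s + (1ℚ + fromℕ n) * x
      ≡⟨ cong₂ _+_ (go n) (trans (cong (_* x) (sym (fromℕ-suc n))) (sym (fromℕ-* (suc n) (suc n ℕ.^ l)))) ⟩
    powerSum (suc l) n + fromℕ (suc n ℕ.^ suc l) ∎
    where
    f = powerSum l n
    x = fromℕ (suc n ℕ.^ l)
    s = partialSum (powerSum l) n

D-reflective : ∀ {p f} → Reflective p f → Reflective (1ℙ ℙ.+ p) (D f)
D-reflective {p} f∈ = +-span (centred-reflective f∈)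
  (neg-closed (reflective-isSubspace (1ℙ ℙ.+ p)) (halfSum-reflective f∈))

-- Only F₁ has to be shifted to be odd or even under n ↦ -1 - n.
shift : ℕ → ℚ
shift zero    = ½
shift (suc _) = 0ℚ

shiftedPowerSum : ℕ → ℕ → ℚ
shiftedPowerSum l n = powerSum l n + shift l

powerSum-0 : ∀ n → powerSum 0 n ≡ fromℕ n
powerSum-0 zero    = refl
powerSum-0 (suc n) = trans (cong (_+ 1ℚ) (powerSum-0 n)) (trans (ℚ.+-comm (fromℕ n) 1ℚ) (sym (fromℕ-suc n)))

D-shiftedPowerSum : ∀ l n → D (shiftedPowerSum l) n ≡ shiftedPowerSum (suc l) n
D-shiftedPowerSum l n = begin
  D (λ n → powerSum l n + shift l) n
    ≡⟨ ≗-cong (D-linear n) (λ n → cong (powerSum l n +_) (sym (ℚ.*-identityʳ (shift l)))) ⟩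
  D (λ n → powerSum l n + shift l * 1ℚ) n
    ≡⟨ +-homo (D-linear n) (powerSum l) (λ _ → shift l * 1ℚ) ⟩
  D (powerSum l) n + D (λ _ → shift l * 1ℚ) n
    ≡⟨ cong₂ _+_ (D-powerSum l n) (trans (*-homo (D-linear n) (shift l) (λ _ → 1ℚ))
         (trans (cong (shift l *_) (D-1 n)) (ℚ.*-zeroʳ (shift l)))) ⟩
  powerSum (suc l) n + 0ℚ ∎
  where open ≡-Reasoning

-- Starting from the odd function n + 1/2, each application of `D` raises the exponent by one and
-- flips the parity.
shiftedPowerSum-reflective : ∀ l → Reflective (parity (suc l)) (shiftedPowerSum l)
shiftedPowerSum-reflective zero    = ≗-span
  (λ n → trans (y^1≡centred n) (cong (_+ ½) (sym (powerSum-0 n)))) (reflective-y^ 1)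
shiftedPowerSum-reflective (suc l) = ≗-span (D-shiftedPowerSum l)
  (reflective-cast (ℙ.suc-homo-⁻¹ l) (D-reflective (shiftedPowerSum-reflective l)))

PowerSums : Parity → Pred (ℕ → ℚ) 0ℓ
PowerSums p = Span {I = ∃ λ l → parity (suc l) ≡ p} (λ (l , _) → powerSum l)

AffinePowerSums : Parity → Pred (ℕ → ℚ) 0ℓ
AffinePowerSums p = Span {I = ⊤ ⊎ ∃ λ l → parity (suc l) ≡ p} λ where
  (inj₁ _)       → λ _ → 1ℚ
  (inj₂ (l , _)) → powerSum l

affine-cast : ∀ {p q f} → p ≡ q → AffinePowerSums p f → AffinePowerSums q f
affine-cast refl f∈ = f∈

affine-const : ∀ {p} c → AffinePowerSums p (λ _ → c)
affine-const c = ≗-span (λ _ → ℚ.*-identityʳ c) (*-span c (basis (inj₁ tt)))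

D-affine : ∀ {p f} → AffinePowerSums p f → AffinePowerSums (1ℙ ℙ.+ p) (D f)
D-affine = span-map (span-isSubspace _) D-linear λ where
  (inj₁ _)          → ≗-span (λ n → sym (D-1 n)) 0-span
  (inj₂ (l , refl)) → ≗-span (λ n → sym (D-powerSum l n)) (basis (inj₂ (suc l , parity-suc (suc l))))

-- From u dy/du = y² - 1/4, `D` sends y^(j+1) to (j + 1)(y^(j+2) - y^j / 4). Solving for y^(j+2)
-- gives the induction, since `D` preserves affine combinations of power sums up to parity.
y^-affine : ∀ j → AffinePowerSums (parity j) (y^ j)
y^-affine zero          = basis (inj₁ tt)
y^-affine (suc zero)    = ≗-span
  (λ n → trans (cong (_+ ½) (powerSum-0 n)) (sym (y^1≡centred n)))
  (+-span (basis (inj₂ (0 , refl))) (affine-const ½))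
y^-affine (suc (suc j)) = ≗-span eq (+-span
  (*-span (½ * ½) (y^-affine j))
  (*-span (ℤ.+ 1 / suc j)
    (affine-cast (ℙ.suc-homo-⁻¹ j) (D-affine (y^-affine (suc j))))))
  where
  open ≡-Reasoning
  open ℚ-Solver.+-*-Solver
  eq : ∀ n → ½ * ½ * y^ j n + (ℤ.+ 1 / suc j) * D (y^ (suc j)) n ≡ y^ (suc (suc j)) n
  eq n = begin
    ½ * ½ * y₀ + i * (centred n * y^ (suc j) n - y₂)
      ≡⟨ cong (λ x → ½ * ½ * y₀ + i * (x - y₂)) (centred-y^ j n) ⟩
    ½ * ½ * y₀ + i * (fromℕ (suc (suc j)) * y₂ - ½ * ½ * c * y₀ - y₂)
      ≡⟨ cong (λ x → ½ * ½ * y₀ + i * (x * y₂ - ½ * ½ * c * y₀ - y₂)) (fromℕ-suc (suc j)) ⟩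
    ½ * ½ * y₀ + i * ((1ℚ + c) * y₂ - ½ * ½ * c * y₀ - y₂)
      ≡⟨ solve 4 (λ i c y₀ y₂ →
           con (½ * ½) :* y₀ :+ i :* ((con 1ℚ :+ c) :* y₂ :+ (:- (con (½ * ½) :* c :* y₀)) :+ (:- y₂)) :=
           con (½ * ½) :* y₀ :+ (i :* c) :* (y₂ :+ (:- (con (½ * ½) :* y₀)))) refl i c y₀ y₂ ⟩
    ½ * ½ * y₀ + (i * c) * (y₂ - ½ * ½ * y₀)
      ≡⟨ cong (λ x → ½ * ½ * y₀ + x * (y₂ - ½ * ½ * y₀)) (1/suc j) ⟩
    ½ * ½ * y₀ + 1ℚ * (y₂ - ½ * ½ * y₀)
      ≡⟨ solve 2 (λ y₀ y₂ → con (½ * ½) :* y₀ :+ con 1ℚ :* (y₂ :+ (:- (con (½ * ½) :* y₀))) := y₂) refl y₀ y₂ ⟩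
    y₂ ∎
    where
    i  = ℤ.+ 1 / suc j
    c  = fromℕ (suc j)
    y₀ = y^ j n
    y₂ = y^ (suc (suc j)) n

reflective⊆affine : ∀ {p f} → Reflective p f → AffinePowerSums p f
reflective⊆affine = span-map (span-isSubspace _) linear-at λ { (j , refl) → y^-affine j }

-- Subtracting the value at 0 changes nothing in `f`, kills constants and fixes each power sum.
affine-vanishing : ∀ {p f} → f 0 ≡ 0ℚ → AffinePowerSums p f → PowerSums p f
affine-vanishing {f = f} f0≡0 f∈ = ≗-span
  (λ n → trans (cong (λ x → f n - x) f0≡0) (ℚ.+-identityʳ (f n)))
  (span-map (span-isSubspace _) (λ n → linear-- (linear-at n) (linear-at 0)) (λ where
    (inj₁ _)       → 0-span
    (inj₂ (l , e)) → ≗-span (λ n → sym (ℚ.+-identityʳ (powerSum l n))) (basis (l , e))) f∈)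

-- Moments and cumulants at a single part

-- letter k l stands for ∑ m^k F_{l + 1}(r_m); a boolean tag tells whether it is a function of α or β.
record Letter : Set where
  constructor letter
  field
    k l         : ℕ
    parity-even : parity k ≡ parity (suc l)

open Letter

pick : Bool → X × X → X
pick b (x , y) = if b then x else y

weight : Bool × Letter → Parity
weight (_ , x) = parity (suc (l x))

module _ (n : ℕ) where

  moment : List (Bool × Letter) → ℚ
  moment w = mean n (λ ab → prod (λ (s , x) → powerSum (l x) (pick s ab)) w)

  shiftedMoment : List (Bool × Letter) → ℚ
  shiftedMoment w = mean n (λ ab → prod (λ (s , x) → shiftedPowerSum (l x) (pick s ab)) w)

  -- The shifted moments have a parity, hence so does their logarithm. Undoing the shift alters only
  -- first-order cumulants, by constants independent of `n`.
  cumulant : List (Bool × Letter) → ℚ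
  cumulant w = logarithm shiftedMoment w + onLetters (λ (_ , x) → - shift (l x)) w

  moment-shift : moment ≗ shiftedMoment ∗ prod (λ (_ , x) → - shift (l x))
  moment-shift w = begin
    mean n (λ ab → prod (λ (s , x) → powerSum (l x) (pick s ab)) w)
      ≡⟨ ≗-cong (mean-linear n) (λ ab → trans
           (prod-cong (λ (s , x) → solve 2 (λ f c → f := (f :+ c) :+ (:- c)) refl
             (powerSum (l x) (pick s ab)) (shift (l x))) w)
           (prod-+ (λ (s , x) → shiftedPowerSum (l x) (pick s ab)) (λ (_ , x) → - shift (l x)) w)) ⟩
    mean n (λ ab → (prod (λ (s , x) → shiftedPowerSum (l x) (pick s ab)) ∗ prod (λ (_ , x) → - shift (l x))) w)
      ≡⟨ ∗-linear (mean-linear n) (λ ab → prod (λ (s , x) → shiftedPowerSum (l x) (pick s ab)))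
           (prod (λ (_ , x) → - shift (l x))) w ⟨
    (shiftedMoment ∗ prod (λ (_ , x) → - shift (l x))) w ∎
    where
    open ≡-Reasoning
    open ℚ-Solver.+-*-Solver

  isExp-cumulant : IsExp cumulant moment
  isExp-cumulant = isExp-≗ (λ _ → refl) (λ w → sym (moment-shift w))
    (isExp-∗ (isExp-logarithm shiftedMoment (trans
        (≗-cong (mean-linear n) (λ _ → sym (ℚ.*-identityˡ 1ℚ))) (mean-const (λ _ → 1ℚ) n)))
      (isExp-prod (λ (_ , x) → - shift (l x))))

shiftedMoment-reflective : ∀ w → Reflective (wordDegree weight w) (λ n → shiftedMoment n w)
shiftedMoment-reflective w = ≗-span
  (λ n → ≗-cong (mean-linear n) (λ ab →
    solve 1 (λ x → con 1ℚ :* con 1ℚ :* x := x) refl (prod (λ (s , x) → shiftedPowerSum (l x) (pick s ab)) w)))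
  (go w (reflective-y^ 0) (reflective-y^ 0))
  where
  open ℚ-Solver.+-*-Solver
  -- `f` and `g` accumulate the factors in `a` and in `b`, until `mean-reflective` applies at the
  -- empty word.
  go : ∀ {p q} {f g : ℕ → ℚ} w → Reflective p f → Reflective q g →
    Reflective (p ℙ.+ q ℙ.+ wordDegree weight w)
      (λ n → mean n (λ ab → f (proj₁ ab) * g (proj₂ ab) * prod (λ (s , x) → shiftedPowerSum (l x) (pick s ab)) w))
  go {p} {q} {f} {g} [] f∈ g∈ = ≗-span
    (λ n → ≗-cong (mean-linear n) (λ (a , b) → sym (ℚ.*-identityʳ (f a * g b))))
    (reflective-cast (sym (ℙ.+-identityʳ (p ℙ.+ q))) (mean-reflective f∈ g∈))
  go {p} {q} {f} {g} ((true , x) ∷ w) f∈ g∈ = ≗-span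
    (λ n → ≗-cong (mean-linear n) (λ (a , b) →
      solve 4 (λ f h g y → (f :* h) :* g :* y := f :* g :* (h :* y)) refl (f a) (shiftedPowerSum (l x) a) (g b) _))
    (reflective-cast
      (trans (cong (ℙ._+ wordDegree weight w) (ℙ-Semigroup.xy∙z≈xz∙y p (parity (suc (l x))) q))
        (ℙ.+-assoc (p ℙ.+ q) (parity (suc (l x))) (wordDegree weight w)))
      (go w (·-closed reflective-isGradedAlgebra f∈ (shiftedPowerSum-reflective (l x))) g∈))
  go {p} {q} {f} {g} ((false , x) ∷ w) f∈ g∈ = ≗-span
    (λ n → ≗-cong (mean-linear n) (λ (a , b) →
      solve 4 (λ f h g y → f :* (g :* h) :* y := f :* g :* (h :* y)) refl (f a) (shiftedPowerSum (l x) b) (g b) _))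
    (reflective-cast
      (trans (cong (ℙ._+ wordDegree weight w) (sym (ℙ.+-assoc p q (parity (suc (l x))))))
        (ℙ.+-assoc (p ℙ.+ q) (parity (suc (l x))) (wordDegree weight w)))
      (go w f∈ (·-closed reflective-isGradedAlgebra g∈ (shiftedPowerSum-reflective (l x)))))

moment-0 : moment 0 ≗ ε
moment-0 []                = refl
moment-0 ((true  , x) ∷ w) = ℚ.*-zeroˡ (moment 0 w)
moment-0 ((false , x) ∷ w) = ℚ.*-zeroˡ (moment 0 w)

-- The parity argument leaves an unknown constant. At multiplicity 0 all variables vanish, hence so
-- do the cumulants, and this removes the constant.
cumulant∈powerSums : ∀ x w → PowerSums (wordDegree weight (x ∷ w)) (λ n → cumulant n (x ∷ w))
cumulant∈powerSums x w = affine-vanishing (isExp-ε⁻¹ moment-0 (isExp-cumulant 0) x w)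
  (+-span
    (reflective⊆affine (logarithm-graded weight reflective-isGradedAlgebra shiftedMoment shiftedMoment-reflective (x ∷ w)))
    (affine-const (onLetters (λ (_ , x) → - shift (l x)) (x ∷ w))))

-- Independence of different parts

-- partSum ψ e is the sum of ψ m (r m ν) over the parts m that may occur in ν = partition e.
partSum : (ℕ → ℕ → ℚ) → Monomial → ℚ
partSum ψ []      = 0ℚ
partSum ψ (n ∷ e) = ψ 1 n + partSum (ψ ∘ suc) e

partSum-cong : ∀ {ψ ψ′ : ℕ → ℕ → ℚ} → (∀ m n → ψ m n ≡ ψ′ m n) → ∀ e → partSum ψ e ≡ partSum ψ′ e
partSum-cong eq []      = refl
partSum-cong eq (n ∷ e) = cong₂ _+_ (eq 1 n) (partSum-cong (eq ∘ suc) e)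

-- The coefficient at `e` of ∏ (1 - u_m) times the sum of Φ(α , β) u^(α + β), taken one variable at
-- a time.
means : Monomial → (Monomial × Monomial → ℚ) → ℚ
means []      Φ = Φ ([] , [])
means (n ∷ e) Φ = mean n (λ (a , b) → means e (λ (α , β) → Φ (a ∷ α , b ∷ β)))

means-linear : ∀ e → Linear (means e)
means-linear []      = linear-at ([] , [])
means-linear (n ∷ e) = linear-∘ (mean-linear n) (λ (a , b) →
  linear-∘ (means-linear e) (λ (α , β) → linear-at (a ∷ α , b ∷ β)))

pick-∷ : ∀ s {a b : X} {α β : List X} → pick s (a ∷ α , b ∷ β) ≡ pick s (a , b) ∷ pick s (α , β)
pick-∷ true  = refl
pick-∷ false = refl

globalMoment : (ℕ → Bool × 𝔸 → ℕ → ℚ) → Monomial → List (Bool × 𝔸) → ℚ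
globalMoment z e w = means e (λ αβ → prod (λ x → partSum (λ m → z m x) (pick (proj₁ x) αβ)) w)

-- Different parts are independent under means, so their cumulants add up.
isExp-globalMoment : ∀ (z : ℕ → Bool × 𝔸 → ℕ → ℚ) (κ : ℕ → ℕ → List (Bool × 𝔸) → ℚ) →
  (∀ m n → IsExp (κ m n) (λ w → mean n (λ ab → prod (λ x → z m x (pick (proj₁ x) ab)) w))) →
  ∀ e → IsExp (λ w → partSum (λ m n → κ m n w) e) (globalMoment z e)
-- With no parts left every variable is 0, and so is every cumulant.
isExp-globalMoment z κ E [] = isExp-≗ κ≗ (λ w → prod-cong (λ { (true , _) → refl ; (false , _) → refl }) w)
  (isExp-prod (λ _ → 0ℚ))
  where
  κ≗ : ∀ w → onLetters (λ _ → 0ℚ) w ≡ 0ℚ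
  κ≗ []          = refl
  κ≗ (_ ∷ [])    = refl
  κ≗ (_ ∷ _ ∷ _) = refl
isExp-globalMoment z κ E (n ∷ e) = isExp-≗ (λ _ → refl) (λ w → sym (independent w))
  (isExp-∗ (E 1 n) (isExp-globalMoment (z ∘ suc) (κ ∘ suc) (E ∘ suc) e))
  where
  open ≡-Reasoning
  here : ℕ × ℕ → List _ → ℚ
  here ab = prod (λ x → z 1 x (pick (proj₁ x) ab))
  there : Monomial × Monomial → List _ → ℚ
  there αβ = prod (λ x → partSum (λ m → z (suc m) x) (pick (proj₁ x) αβ))
  independent : ∀ w → globalMoment z (n ∷ e) w ≡ ((λ u → mean n (λ ab → here ab u)) ∗ globalMoment (z ∘ suc) e) w
  independent w = begin
    globalMoment z (n ∷ e) w
      ≡⟨ ≗-cong (mean-linear n) (λ ab → ≗-cong (means-linear e) (λ αβ → trans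
           (prod-cong (λ (s , x) → cong (partSum (λ m → z m (s , x))) (pick-∷ s)) w)
           (prod-+ (λ x → z 1 x (pick (proj₁ x) ab)) (λ x → partSum (λ m → z (suc m) x) (pick (proj₁ x) αβ)) w))) ⟩
    mean n (λ ab → means e (λ αβ → (here ab ∗ there αβ) w))
      ≡⟨ ≗-cong (mean-linear n) (λ ab → ∗-linearʳ (means-linear e) (here ab) there w) ⟨
    mean n (λ ab → (here ab ∗ globalMoment (z ∘ suc) e) w)
      ≡⟨ ∗-linear (mean-linear n) here (globalMoment (z ∘ suc) e) w ⟨
    ((λ u → mean n (λ ab → here ab u)) ∗ globalMoment (z ∘ suc) e) w ∎

weightedSum : ℕ → (ℕ → ℚ) → Monomial → ℚ
weightedSum k f = partSum (λ m n → fromℕ (m ℕ.^ k) * f n)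

weightedSum-linear : ∀ k e → Linear (λ f → weightedSum k f e)
weightedSum-linear k = go (λ m → fromℕ (m ℕ.^ k))
  where
  go : ∀ (c : ℕ → ℚ) e → Linear (λ f → partSum (λ m n → c m * f n) e)
  go c []      = record { ≗-cong = λ _ → refl ; +-homo = λ _ _ → refl ; *-homo = λ c _ → sym (ℚ.*-zeroʳ c) }
  go c (n ∷ e) = linear-+ (linear-* (c 1) (linear-at n)) (go (c ∘ suc) e)

totalExponent : List (Bool × Letter) → ℕ
totalExponent []            = 0
totalExponent ((_ , x) ∷ w) = k x ℕ.+ totalExponent w

prod-power : ∀ m w → prod (λ (_ , x) → fromℕ (m ℕ.^ k x)) w ≡ fromℕ (m ℕ.^ totalExponent w)
prod-power m []            = refl
prod-power m ((_ , x) ∷ w) = begin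
  fromℕ (m ℕ.^ k x) * prod (λ (_ , x) → fromℕ (m ℕ.^ k x)) w  ≡⟨ cong (fromℕ (m ℕ.^ k x) *_) (prod-power m w) ⟩
  fromℕ (m ℕ.^ k x) * fromℕ (m ℕ.^ totalExponent w)           ≡⟨ fromℕ-* (m ℕ.^ k x) (m ℕ.^ totalExponent w) ⟨
  fromℕ (m ℕ.^ k x ℕ.* m ℕ.^ totalExponent w)                 ≡⟨ cong fromℕ (ℕ.^-distribˡ-+-* m (k x) (totalExponent w)) ⟨
  fromℕ (m ℕ.^ (k x ℕ.+ totalExponent w))                     ∎
  where open ≡-Reasoning

-- This is where the evenness of k + l enters: the exponent of m in a joint cumulant has the same
-- parity as the Faulhaber polynomials that express it.
parity-totalExponent : ∀ w → parity (totalExponent w) ≡ wordDegree weight w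
parity-totalExponent []            = refl
parity-totalExponent ((_ , x) ∷ w) = trans (ℙ.+-homo-+ (k x) (totalExponent w))
  (cong₂ ℙ._+_ (parity-even x) (parity-totalExponent w))

letterValue : Letter → Monomial → ℚ
letterValue x = weightedSum (k x) (powerSum (l x))

taggedMoment : Monomial → List (Bool × Letter) → ℚ
taggedMoment = globalMoment (λ m (_ , x) n → fromℕ (m ℕ.^ k x) * powerSum (l x) n)

-- At the part `m` each variable carries the scalar m^k. By homogeneity these scalars combine to m
-- to the power `totalExponent w` in front of the one-part cumulant.
isExp-taggedMoment : ∀ e →
  IsExp (λ w → weightedSum (totalExponent w) (λ n → cumulant n w) e) (taggedMoment e)
isExp-taggedMoment e = isExp-≗
  (λ w → partSum-cong (λ m n → cong (_* cumulant n w) (prod-power m w)) e) (λ _ → refl)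
  (isExp-globalMoment _ (λ m n w → prod (λ (_ , x) → fromℕ (m ℕ.^ k x)) w * cumulant n w)
    (λ m n → isExp-≗ (λ _ → refl)
      (λ w → trans (sym (*-homo (mean-linear n) (prod (λ (_ , x) → fromℕ (m ℕ.^ k x)) w) _))
        (≗-cong (mean-linear n) (λ ab → sym (prod-* (λ (_ , x) → fromℕ (m ℕ.^ k x))
          (λ (s , x) → powerSum (l x) (pick s ab)) w))))
      (isExp-scale (λ (_ , x) → fromℕ (m ℕ.^ k x)) (isExp-cumulant n)))
    e)

-- The generators as sums over parts

∑₁-cong⁺ : ∀ {f g : ℕ → ℚ} n → (∀ i → f (suc i) ≡ g (suc i)) → ∑₁ n f ≡ ∑₁ n g
∑₁-cong⁺ zero    eq = refl
∑₁-cong⁺ (suc n) eq = cong₂ _+_ (∑₁-cong⁺ n eq) (eq n)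

∑₁-head : ∀ n (f : ℕ → ℚ) → ∑₁ (suc n) f ≡ f 1 + ∑₁ n (f ∘ suc)
∑₁-head zero    f = ℚ.+-comm 0ℚ (f 1)
∑₁-head (suc n) f = trans (cong (_+ f (suc (suc n))) (∑₁-head n f)) (ℚ.+-assoc (f 1) _ _)

∑₁-extend : ∀ n j {f : ℕ → ℚ} → (∀ i → n < i → f i ≡ 0ℚ) → ∑₁ (j ℕ.+ n) f ≡ ∑₁ n f
∑₁-extend n zero    eq = refl
∑₁-extend n (suc j) eq = trans
  (cong₂ _+_ (∑₁-extend n j eq) (eq (suc j ℕ.+ n) (s≤s (ℕ.m≤n+m n j))))
  (ℚ.+-identityʳ _)

partSum≡∑₁ : ∀ ψ e → partSum ψ e ≡ ∑₁ (length e) (λ m → ψ m (exponent e (ℕ.pred m)))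
partSum≡∑₁ ψ []      = refl
partSum≡∑₁ ψ (n ∷ e) = trans
  (cong (ψ 1 n +_) (trans (partSum≡∑₁ (ψ ∘ suc) e) (∑₁-cong⁺ (length e) (λ _ → refl))))
  (sym (∑₁-head (length e) (λ m → ψ m (exponent (n ∷ e) (ℕ.pred m)))))

exponent-large : ∀ e j → length e ≤ j → exponent e j ≡ 0
exponent-large []      j       _         = refl
exponent-large (n ∷ e) (suc j) (s≤s e≤j) = exponent-large e j e≤j

-- The cut-offs `size (partition e)` and `length e` are not comparable in general, so both sums are
-- extended to their total; the extra terms have multiplicity 0.
∑₁-partition : ∀ (ψ : ℕ → ℕ → ℚ) → (∀ m → ψ m 0 ≡ 0ℚ) → ∀ e →
  ∑₁ (size (partition e)) (λ m → ψ m (r m (partition e))) ≡ partSum ψ e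
∑₁-partition ψ ψ0 e = begin
  ∑₁ N f
    ≡⟨ ∑₁-extend N (length e) (λ i N<i → trans (cong (ψ i) (count-large i (parts ν) N<i)) (ψ0 i)) ⟨
  ∑₁ (length e ℕ.+ N) f
    ≡⟨ cong (λ n → ∑₁ n f) (ℕ.+-comm (length e) N) ⟩
  ∑₁ (N ℕ.+ length e) f
    ≡⟨ ∑₁-extend (length e) N beyond ⟩
  ∑₁ (length e) f
    ≡⟨ ∑₁-cong⁺ (length e) (λ j → cong (ψ (suc j)) (r-partition e j)) ⟩
  ∑₁ (length e) (λ m → ψ m (exponent e (ℕ.pred m)))
    ≡⟨ partSum≡∑₁ ψ e ⟨
  partSum ψ e ∎
  where
  open ≡-Reasoning
  ν = partition e
  N = size ν
  f : ℕ → ℚ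
  f m = ψ m (r m ν)
  beyond : ∀ i → length e < i → f i ≡ 0ℚ
  beyond (suc j) (s≤s e≤j) = trans
    (cong (ψ (suc j)) (trans (r-partition e j) (exponent-large e j e≤j))) (ψ0 (suc j))

eval-faulhaber : ∀ l n → eval (faulhaber (suc l)) (fromℕ n) ≡ powerSum l n
eval-faulhaber l zero    = trans (sym (constantTerm≡eval-0 (faulhaber (suc l))))
  (IsFaulhaber.zeroConstantTerm (isFaulhaber (suc l)))
eval-faulhaber l (suc n) = IsFaulhaber.powerSum (isFaulhaber (suc l)) (suc n) (s≤s z≤n)

-- The sum over parts vanishes at the empty partition, so the value there is exactly the additive
-- constant with the Bernoulli number.
T-partition : ∀ k l e → T k (suc l) (partition e) ≡ T k (suc l) (partition []) + weightedSum k (powerSum l) e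
T-partition k l e = begin
  C + ∑₁ (size (partition e)) (λ m → fromℕ (m ℕ.^ k) * eval (faulhaber (suc l)) (fromℕ (r m (partition e))))
    ≡⟨ cong (C +_) (∑₁-cong (size (partition e)) (λ m → cong (fromℕ (m ℕ.^ k) *_) (eval-faulhaber l (r m (partition e))))) ⟩
  C + ∑₁ (size (partition e)) (λ m → fromℕ (m ℕ.^ k) * powerSum l (r m (partition e)))
    ≡⟨ cong (C +_) (∑₁-partition (λ m n → fromℕ (m ℕ.^ k) * powerSum l n) (λ m → ℚ.*-zeroʳ (fromℕ (m ℕ.^ k))) e) ⟩
  C + weightedSum k (powerSum l) e
    ≡⟨ cong (_+ weightedSum k (powerSum l) e) (ℚ.+-identityʳ C) ⟨
  C + 0ℚ + weightedSum k (powerSum l) e ∎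
  where
  open ≡-Reasoning
  2[k+l]≢0 : NonZero (2 ℕ.* (k ℕ.+ suc l))
  2[k+l]≢0 rewrite ℕ.+-suc k l = _
  C = - (bernoulli (k ℕ.+ suc l) * (_/_ (ℤ.+ 1) (2 ℕ.* (k ℕ.+ suc l)) {{2[k+l]≢0}})) * (δ (suc l) 1 + δ k 0)

-- Tagged moments belong to the algebra

2∣⇒parity≡0 : ∀ {n} → 2 ∣ n → parity n ≡ 0ℙ
2∣⇒parity≡0 (divides q refl) = trans (ℙ.*-homo-* q 2) (ℙ.*-zeroʳ (parity q))

parity≡0⇒2∣ : ∀ n → parity n ≡ 0ℙ → 2 ∣ n
parity≡0⇒2∣ zero          _  = divides 0 refl
parity≡0⇒2∣ (suc (suc n)) eq with divides q n≡ ← parity≡0⇒2∣ n eq = divides (suc q) (cong (suc ∘ suc) n≡)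

2∣+⇒parity≡ : ∀ k l → 2 ∣ k ℕ.+ l → parity k ≡ parity l
2∣+⇒parity≡ k l 2∣k+l = ℙ.+-cancelʳ-≡ (parity l) (parity k) (parity l)
  (trans (sym (ℙ.+-homo-+ k l)) (trans (2∣⇒parity≡0 2∣k+l) (sym (ℙ.p+p≡0ℙ (parity l)))))

parity≡⇒2∣+ : ∀ k l → parity k ≡ parity l → 2 ∣ k ℕ.+ l
parity≡⇒2∣+ k l eq = parity≡0⇒2∣ (k ℕ.+ l)
  (trans (ℙ.+-homo-+ k l) (trans (cong (ℙ._+ parity l) eq) (ℙ.p+p≡0ℙ (parity l))))

-- Membership in `𝒯` read on monomials, where `means` and `partSum` recurse on exponents.
𝒯° : Pred (Monomial → ℚ) 0ℓ
𝒯° H = ∃ λ h → h ∈ 𝒯 × (∀ e → h (partition e) ≡ H e)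

𝒯°-isGradedAlgebra : IsGradedAlgebra {X = Monomial} (λ _ → 𝒯°)
𝒯°-isGradedAlgebra = record
  { isSubspace = λ _ → record
    { 0-closed = (λ _ → 0ℚ) , constant 0ℚ , λ _ → refl
    ; +-closed = λ (f , f∈ , f≡) (g , g∈ , g≡) →
        (λ ν → f ν + g ν) , add f∈ g∈ , λ e → cong₂ _+_ (f≡ e) (g≡ e)
    ; *-closed = λ c (f , f∈ , f≡) → (λ ν → c * f ν) , multiply (constant c) f∈ , λ e → cong (c *_) (f≡ e)
    ; ≗-closed = λ eq (f , f∈ , f≡) → f , f∈ , λ e → trans (f≡ e) (eq e)
    }
  ; 1-closed   = (λ _ → 1ℚ) , constant 1ℚ , λ _ → refl
  ; ·-closed   = λ (f , f∈ , f≡) (g , g∈ , g≡) →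
      (λ ν → f ν * g ν) , multiply f∈ g∈ , λ e → cong₂ _*_ (f≡ e) (g≡ e)
  }

𝒯°-isSubspace : IsSubspace 𝒯°
𝒯°-isSubspace = isSubspace 𝒯°-isGradedAlgebra 0ℙ

-- For a basis function `powerSum l` the parity condition makes `T k (suc l)` a generator, and the
-- weighted sum differs from it by its value at the empty partition.
weightedSum∈𝒯° : ∀ k {f} → PowerSums (parity k) f → 𝒯° (weightedSum k f)
weightedSum∈𝒯° k = span-map 𝒯°-isSubspace (weightedSum-linear k) λ (l , l≡k) →
  (λ ν → T k (suc l) ν + - T k (suc l) (partition [])) ,
  add (generator k (suc l) (parity≡⇒2∣+ k (suc l) (sym l≡k))) (constant (- T k (suc l) (partition []))) ,
  λ e → trans (cong (_+ - T k (suc l) (partition [])) (T-partition k l e))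
    (solve 2 (λ c x → c :+ x :+ (:- c) := x) refl (T k (suc l) (partition [])) (weightedSum k (powerSum l) e))
  where open ℚ-Solver.+-*-Solver

-- The differential equation of the exponential writes the moment of `x ∷ w` through cumulants and
-- moments of words no longer than `w`. The cumulants are already known to lie in `𝒯°`.
taggedMoment∈𝒯° : ∀ w → 𝒯° (λ e → taggedMoment e w)
taggedMoment∈𝒯° w = go (suc (length w)) w ℕ.≤-refl
  where
  κ∈𝒯° : ∀ x w → 𝒯° (weightedSum (totalExponent (x ∷ w)) (λ n → cumulant n (x ∷ w)))
  κ∈𝒯° x w = weightedSum∈𝒯° (totalExponent (x ∷ w))
    (subst (λ p → PowerSums p (λ n → cumulant n (x ∷ w))) (sym (parity-totalExponent (x ∷ w)))
      (cumulant∈powerSums x w))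
  go : ∀ j w → length w < j → 𝒯° (λ e → taggedMoment e w)
  go (suc j) []      _         = ≗-closed 𝒯°-isSubspace
    (λ e → sym (empty (isExp-taggedMoment e))) (1-closed 𝒯°-isGradedAlgebra)
  go (suc j) (x ∷ w) (s≤s w<j) = ≗-closed 𝒯°-isSubspace
    (λ e → sym (derivative (isExp-taggedMoment e) x w))
    (∗-graded (λ _ → 0ℙ) 𝒯°-isGradedAlgebra 0ℙ 0ℙ _ taggedMoment w
      (λ u _ → κ∈𝒯° x u) (λ u u≤w → go j u (ℕ.≤-<-trans u≤w w<j)))

wordValue : List Letter → Monomial → ℚ
wordValue w e = prod (λ x → letterValue x e) w

prod-++ : ∀ (z : 𝔸 → ℚ) u v → prod z (u ++ v) ≡ prod z u * prod z v
prod-++ z []      v = sym (ℚ.*-identityˡ (prod z v))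
prod-++ z (x ∷ u) v = trans (cong (z x *_) (prod-++ z u v)) (sym (ℚ.*-assoc (z x) (prod z u) (prod z v)))

prod-map : ∀ (z : 𝔸 → ℚ) (h : X → 𝔸) w → prod z (List.map h w) ≡ prod (z ∘ h) w
prod-map z h []      = refl
prod-map z h (x ∷ w) = cong (z (h x) *_) (prod-map z h w)

-- Words are products of generators stripped of their constants; the empty word supplies the
-- constants, and concatenation the products.
𝒯⇒span : ∀ {f} → f ∈ 𝒯 → Span wordValue (λ e → f (partition e))
𝒯⇒span (generator k (suc l) 2∣k+l) = ≗-span
  (λ e → trans
    (solve 2 (λ c x → c :* con 1ℚ :+ x :* con 1ℚ := c :+ x) refl (T k (suc l) (partition [])) (weightedSum k (powerSum l) e))
    (sym (T-partition k l e)))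
  (+-span (*-span (T k (suc l) (partition [])) (basis [])) (basis (letter k l (2∣+⇒parity≡ k (suc l) 2∣k+l) ∷ [])))
  where open ℚ-Solver.+-*-Solver
𝒯⇒span (constant c)     = ≗-span (λ _ → ℚ.*-identityʳ c) (*-span c (basis []))
𝒯⇒span (add f∈ g∈)      = +-span (𝒯⇒span f∈) (𝒯⇒span g∈)
𝒯⇒span (multiply {f} {g} f∈ g∈) = span-map (span-isSubspace wordValue) (λ e → linear-*ʳ (g (partition e)) (linear-at e))
  (λ u → span-map (span-isSubspace wordValue) (pointwise-linear (wordValue u))
    (λ v → ≗-span (λ e → prod-++ (λ x → letterValue x e) u v) (basis (u ++ v)))
    (𝒯⇒span g∈))
  (𝒯⇒span f∈)
𝒯⇒span (resp-≗ eq f∈)   = ≗-span (λ e → eq (partition e)) (𝒯⇒span f∈)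

-- By bilinearity it suffices to take two words; tagging their letters with `true` and `false` and
-- concatenating turns the expectation into a single tagged moment.
means∈𝒯° : ∀ {f g} → f ∈ 𝒯 → g ∈ 𝒯 →
  𝒯° (λ e → means e (λ (α , β) → f (partition α) * g (partition β)))
means∈𝒯° {f} {g} f∈ g∈ = span-map 𝒯°-isSubspace
  (λ e → linear-∘ (means-linear e) (λ (α , β) → linear-*ʳ (g (partition β)) (linear-at α)))
  (λ u → span-map 𝒯°-isSubspace
    (λ e → linear-∘ (means-linear e) (λ (α , β) → linear-* (wordValue u α) (linear-at β)))
    (λ v → ≗-closed 𝒯°-isSubspace (λ e → ≗-cong (means-linear e) (tagged u v))
      (taggedMoment∈𝒯° (List.map (true ,_) u ++ List.map (false ,_) v)))
    (𝒯⇒span g∈))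
  (𝒯⇒span f∈)
  where
  tagged : ∀ u v (αβ : Monomial × Monomial) →
    prod (λ (s , x) → letterValue x (pick s αβ)) (List.map (true ,_) u ++ List.map (false ,_) v) ≡
    wordValue u (proj₁ αβ) * wordValue v (proj₂ αβ)
  tagged u v αβ = trans (prod-++ z (List.map (true ,_) u) (List.map (false ,_) v))
    (cong₂ _*_ (prod-map z (true ,_) u) (prod-map z (false ,_) v))
    where
    z : Bool × Letter → ℚ
    z (s , x) = letterValue x (pick s αβ)

-- Clearing denominators

antidiagonal-ℓ : ∀ {ℓ : (X → ℚ) → ℚ} → Linear ℓ → ∀ n (G : X → ℕ → ℕ → ℚ) →
  antidiagonal n (λ a b → ℓ (λ x → G x a b)) ≡ ℓ (λ x → antidiagonal n (G x))
antidiagonal-ℓ L zero    G = refl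
antidiagonal-ℓ {ℓ = ℓ} L (suc n) G = trans
  (cong (ℓ (λ x → G x 0 (suc n)) +_) (antidiagonal-ℓ L n (λ x a b → G x (suc a) b)))
  (sym (+-homo L _ _))

factorisations-ℓ : ∀ {ℓ : (X → ℚ) → ℚ} → Linear ℓ → ∀ e (G : X → Monomial → Monomial → ℚ) →
  factorisations e (λ α β → ℓ (λ x → G x α β)) ≡ ℓ (λ x → factorisations e (G x))
factorisations-ℓ L []      G = refl
factorisations-ℓ L (n ∷ e) G = trans
  (antidiagonal-cong n (λ a b _ → factorisations-ℓ L e (λ x α β → G x (a ∷ α) (b ∷ β))))
  (antidiagonal-ℓ L n _)

antidiagonal-mean : ∀ n φ → antidiagonal n (λ a _ → mean a φ) ≡ antidiagonal n (λ a b → φ (a , b))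
antidiagonal-mean zero    φ = refl
antidiagonal-mean (suc n) φ = trans (antidiagonal-last n (λ a _ → mean a φ))
  (trans (cong (_+ mean (suc n) φ) (antidiagonal-mean n φ))
    (solve 2 (λ a b → a :+ (b :+ (:- a)) := b) refl
      (antidiagonal n (λ a b → φ (a , b))) (antidiagonal (suc n) (λ a b → φ (a , b)))))
  where open ℚ-Solver.+-*-Solver

-- Convolution with the series whose coefficients are all 1 is division by ∏ (1 - u_m). It undoes
-- the factor in `means`, one variable at a time by telescoping.
factorisations-means : ∀ e Φ → factorisations e (λ α _ → means α Φ) ≡ factorisations e (λ α β → Φ (α , β))
factorisations-means []      Φ = refl
factorisations-means (n ∷ e) Φ = begin
  antidiagonal n (λ a b → factorisations e (λ α β → mean a (λ (x , y) → means α (Φ′ x y))))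
    ≡⟨ antidiagonal-cong n (λ a b _ → trans
         (factorisations-ℓ (mean-linear a) e (λ (x , y) α β → means α (Φ′ x y)))
         (≗-cong (mean-linear a) (λ (x , y) → factorisations-means e (Φ′ x y)))) ⟩
  antidiagonal n (λ a b → mean a (λ (x , y) → factorisations e (λ α β → Φ′ x y (α , β))))
    ≡⟨ antidiagonal-mean n (λ (x , y) → factorisations e (λ α β → Φ′ x y (α , β))) ⟩
  antidiagonal n (λ a b → factorisations e (λ α β → Φ′ a b (α , β))) ∎
  where
  open ≡-Reasoning
  Φ′ : ℕ → ℕ → Monomial × Monomial → ℚ
  Φ′ x y (α , β) = Φ (x ∷ α , y ∷ β)

-- With P the denominator, the hypothesis on `h` says H P = F G; dividing by P twice gives the
-- claim.
⟪⟫-unique : ∀ f g h → (∀ e → h (partition e) ≡ means e (λ (α , β) → f (partition α) * g (partition β))) →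
  ⟪ h ⟫ ≈ ⟪ f ⟫ ⋆ ⟪ g ⟫
⟪⟫-unique f g h h≡ e = begin
  coeff (H ⋆ Q) e                   ≡⟨ ⋆-cong H ((H ⋆ P) ⋆ Q) Q Q
                                         (λ e → sym (trans (⋆-assoc H P Q e) (trans
                                           (⋆-cong H H (P ⋆ Q) 𝟙 (λ _ → refl) (⋆-inverseʳ P refl) e) (⋆-identityʳ H e))))
                                         (λ _ → refl) e ⟩
  coeff (((H ⋆ P) ⋆ Q) ⋆ Q) e       ≡⟨ ⋆-cong ((H ⋆ P) ⋆ Q) ((F ⋆ G) ⋆ Q) Q Q
                                         (⋆-cong (H ⋆ P) (F ⋆ G) Q Q cleared (λ _ → refl)) (λ _ → refl) e ⟩
  coeff (((F ⋆ G) ⋆ Q) ⋆ Q) e       ≡⟨ ⋆-cong ((F ⋆ G) ⋆ Q) ((F ⋆ Q) ⋆ G) Q Q swap (λ _ → refl) e ⟩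
  coeff (((F ⋆ Q) ⋆ G) ⋆ Q) e       ≡⟨ ⋆-assoc (F ⋆ Q) G Q e ⟩
  coeff ((F ⋆ Q) ⋆ (G ⋆ Q)) e       ∎
  where
  open ≡-Reasoning
  P = ∑ν λ _ → 1ℚ
  Q = P ⁻¹
  F = ∑ν f
  G = ∑ν g
  H = ∑ν h
  cleared : H ⋆ P ≈ F ⋆ G
  cleared e = trans
    (factorisations-cong e (λ α β _ → trans (ℚ.*-identityʳ (h (partition α))) (h≡ α)))
    (factorisations-means e (λ (α , β) → f (partition α) * g (partition β)))
  swap : (F ⋆ G) ⋆ Q ≈ (F ⋆ Q) ⋆ G
  swap e = trans (⋆-assoc F G Q e) (trans
    (⋆-cong F F (G ⋆ Q) (Q ⋆ G) (λ _ → refl) (⋆-comm G Q) e)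
    (sym (⋆-assoc F Q G e)))

theorem4p2p1 : ∀ (f g : Partition → ℚ) → f ∈ 𝒯 → g ∈ 𝒯 → (f ⊙ g) ∈ 𝒯
theorem4p2p1 f g f∈ g∈ with means∈𝒯° f∈ g∈
-- `h` and `f ⊙ g` have the same bracket, so they agree pointwise.
... | h , h∈ , h≡ = resp-≗
  (⟪⟫-injective {h} {f ⊙ g} (λ e → trans (⟪⟫-unique f g h h≡ e) (sym (⟪⟫-⊙ f g e)))) h∈
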